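{- Let $N$ be a positive integer with $\sigma_\infty(\sigma_\infty(N))=2N$ (an infinitary superperfect number) such that $\omega(\sigma_\infty(N))\le 2$. Then $N=2$ or $N=9$.
   Context: $\omega(m)$ denotes the number of distinct prime factors of $m$. Infinitary divisors: every divisor of $n$ is a $0$-ary divisor; a divisor $d$ of $n$ is a $(k+1)$-ary divisor if $d$ and $n/d$ have no common $k$-ary divisor other than $1$; for a prime $p$, $p^f$ is an infinitary divisor of $p^e$ if it is an $(e-1)$-ary divisor of $p^e$, which holds iff the set of positions of $1$'s in the binary expansion of $f$ is a subset of that of $e$. For $n=\prod_i p_i^{e_i}$, a divisor $\prod_i p_i^{f_i}$ is an infinitary divisor iff each $p_i^{f_i}$ is an infinitary divisor of $p_i^{e_i}$. $\sigma_\infty(n)$ is the sum of infinitary divisors of $n$; explicitly, if $e_i=\sum_j y_{ij}2^j$ with $y_{ij}\in\{0,1\}$, then $\sigma_\infty(n)=\prod_i\prod_{j:\,y_{ij}=1}(1+p_i^{2^j})$. -}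

module Defs where

open import Data.Nat using (ℕ; zero; suc; _+_; _*_; _≟_; _/_; _%_)
open import Data.Nat.Divisibility using (_∣?_)
open import Data.Nat.Primality using (prime?)
open import Data.Bool using (Bool; true; false; _∧_; _∨_; not; T?)
open import Data.List using (List; filter; length; upTo; map)
open import Data.Bool.ListAction using (and)
open import Data.Nat.ListAction using (sum)
open import Relation.Nullary.Decidable using (⌊_⌋)

-- Exponent of p = q+2 in n, computed with fuel (fuel n suffices since
-- the exponent of a prime in n ≥ 1 is < n).
vpAux : ℕ → ℕ → ℕ → ℕ
vpAux zero q n = 0
vpAux (suc fuel) q n with ⌊ suc (suc q) ∣? n ⌋ ∧ not ⌊ n ≟ 0 ⌋
... | false = 0
... | true = suc (vpAux fuel q (n / suc (suc q)))

-- v_p(n) for n ≥ 1 and p ≥ 2 (junk value 0 for p < 2 or n = 0).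
vp : ℕ → ℕ → ℕ
vp zero n = 0
vp (suc zero) n = 0
vp (suc (suc q)) n = vpAux n q n

-- bitSubset f e = true iff the set of positions of 1's in the binary
-- expansion of f is a subset of that of e (fuel f suffices).
bitSubsetAux : ℕ → ℕ → ℕ → Bool
bitSubsetAux zero f e = true
bitSubsetAux (suc fuel) f e =
  (not ⌊ f % 2 ≟ 1 ⌋ ∨ ⌊ e % 2 ≟ 1 ⌋) ∧ bitSubsetAux fuel (f / 2) (e / 2)

bitSubset : ℕ → ℕ → Bool
bitSubset f e = bitSubsetAux (suc f) f e

primesUpTo : ℕ → List ℕ
primesUpTo n = filter prime? (upTo (suc n))

-- d is an infinitary divisor of n (n ≥ 1): d ∣ n and for each prime p,
-- p^{v_p(d)} is an infinitary divisor of p^{v_p(n)}, i.e. the binary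
-- digits of v_p(d) form a subset of those of v_p(n).
isInfDiv : ℕ → ℕ → Bool
isInfDiv d n = ⌊ d ∣? n ⌋ ∧ not ⌊ d ≟ 0 ⌋
  ∧ and (map (λ p → bitSubset (vp p d) (vp p n)) (primesUpTo n))

σ∞ : ℕ → ℕ
σ∞ n = sum (filter (λ d → T? (isInfDiv d n)) (upTo (suc n)))

ω : ℕ → ℕ
ω m = length (filter (λ p → p ∣? m) (primesUpTo m))

{-# OPTIONS --safe #-}
module Submission where

-- A component of n is a prime power r ^ 2 ^ l, one for each binary digit 1 at position l of
-- the exponent of r in n; n is the product of its components q and σ∞ n = ∏ (1 + q).
-- Put M = σ∞ N, so that σ∞ M = 2N. If M is odd, N has only components 2 ^ 2 ^ l, and l ≥ 1
-- is impossible because primes dividing 1 + 2 ^ 2 ^ l are 1 mod 4; so N = 2.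
-- If M = 2 ^ e p ^ f, every component q of N has 1 + q = 2 ^ a p ^ b, with a = 1 when
-- q ≡ 1 mod 4. As (σ∞ N / N)(σ∞ M / M) = 2, the components 2, 3, 5, 9 can occur only rarely,
-- so e and f are even in most cases; then 2N is a product of numbers 1 + y² and all odd
-- components are 1 mod 4. For odd N this makes (σ∞ N / N)(σ∞ M / M) < 2, since
-- ∏ (1 + 1/q) over distinct q = 2p ^ b - 1 is at most 4/3; the remaining case f = 1 gives 9.
-- For even N, p = 1 + 2 ^ 2 ^ i is a Fermat prime, and congruences modulo 3, 5 and 8 force
-- b to be even for every odd component, which contradicts the parity of f; if f is odd, the
-- factor p + 1 of 2N contributes a prime 3 mod 4 that no component can carry.

open import Defs
open import Data.Bool using (Bool; true; false; T; T?; _∧_; not)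
open import Data.Bool.ListAction using (and)
open import Data.Bool.Properties using (T-∧; T-≡)
open import Data.Empty using (⊥; ⊥-elim)
open import Data.List using (List; []; _∷_; _++_; cartesianProductWith; filter; length; map; upTo)
open import Data.List.Membership.DecPropositional as DecMembership using ()
open import Data.List.Membership.Propositional using (_∈_)
open import Data.List.Membership.Propositional.Properties
open import Data.List.Membership.Propositional.Properties.WithK using (unique∧set⇒bag)
open import Data.List.Properties using (map-++)
open import Data.List.Relation.Binary.BagAndSetEquality using (∼bag⇒↭)
open import Data.List.Relation.Binary.Permutation.Propositional using (_↭_; ↭-sym; ↭⇒↭ₛ)
open import Data.List.Relation.Binary.Permutation.Propositional.Properties as Perm using (∈-resp-↭; shift)
import Data.List.Relation.Binary.Permutation.Setoid.Properties as SetoidPerm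
open import Data.List.Relation.Unary.All as All using (All; []; _∷_)
open import Data.List.Relation.Unary.AllPairs using ([]; _∷_)
open import Data.List.Relation.Unary.Any using (here; there)
open import Data.List.Relation.Unary.Unique.Propositional using (Unique)
import Data.List.Relation.Unary.Unique.Propositional.Properties as Uniq
open import Data.Nat
open import Data.Nat.Coprimality using (Coprime; coprime-divisor)
open import Data.Nat.Divisibility
open import Data.Nat.DivMod
open import Data.Nat.Induction using (<-rec)
open import Data.Nat.ListAction using (sum; product)
open import Data.Nat.ListAction.Properties
open import Data.Nat.Primality
open import Data.Nat.Primality.Factorisation using (factorise)
open import Data.Nat.Properties
open import Data.Nat.Tactic.RingSolver using (solve-∀)
open import Data.Product using (∃-syntax; _×_; _,_; proj₁; proj₂)
open import Data.Sum using (_⊎_; inj₁; inj₂)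
open import Data.Unit using (tt)
open import Function.Base using (_∘_; case_of_)
open import Function.Bundles using (_⇔_; mk⇔; Equivalence)
open import Relation.Binary.PropositionalEquality
open import Relation.Nullary using (¬_; Dec; yes; no; contradiction)
open import Relation.Nullary.Decidable using (⌊_⌋; ¬?; _→-dec_; _⊎-dec_; toWitness; fromWitness)

open DecMembership _≟_ using (_∈?_)
open SetoidPerm (setoid ℕ) using (Unique-resp-↭)

-- The obstacle is a component of N that is 3 mod 4, for it leaves the exponent of 2 in `1 + q`
-- free, whereas `q ≡ 1 mod 4` gives `1 + q ≡ 2 mod 4`. A binary digit of e or f at position at
-- least 1 contributes a factor `y² + 1` to 2N, and the odd primes dividing it are 1 mod 4. So
-- components that are 3 mod 4 can only come from the lowest digits of e and f, and the case
-- distinctions are about these digits. A lowest digit 1 makes 2 or p itself a component of M. This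
-- costs a factor 3/2 or (p + 1)/p of the available 2 and often forces a small component such as 3
-- into N; several of these budgets are met with equality, so strictness has to come from elsewhere.
-- For large p the factor (p + 1)/p costs too little, and the arithmetic of (p + 1)/6 takes over.
-- For even N the parity clash is this: the component p - 1 contributes one p to M, the others even
-- powers of p, so f is odd. The prime 3 gives no information modulo 3, so the argument moves to the
-- second lowest digits and to residues modulo 8; the prime 5 stands apart because 9 = 2 · 5 - 1 can
-- be a component.

∤⇒NonZero : ∀ {r m} → ¬ r ∣ m → NonZero m
∤⇒NonZero {r} {zero} r∤m = contradiction (r ∣0) r∤m
∤⇒NonZero {r} {suc m} _ = _

n<m^n : ∀ {m} → 1 < m → ∀ n → n < m ^ n
n<m^n 1<m zero = s≤s z≤n
n<m^n {m} 1<m (suc n) = begin-strict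
  suc n       ≤⟨ n<m^n 1<m n ⟩
  m ^ n       ≡⟨ *-identityˡ (m ^ n) ⟨
  1 * m ^ n   <⟨ *-monoˡ-< (m ^ n) {{m^n≢0 m n {{>-nonZero (<-trans (s≤s z≤n) 1<m)}}}} 1<m ⟩
  m * m ^ n   ∎
  where open ≤-Reasoning

-- Valuations at a prime.

vpAux-spec : ∀ fuel q {a m} → ¬ 2+ q ∣ m → a ≤ fuel → vpAux fuel q (2+ q ^ a * m) ≡ a
vpAux-spec zero q {zero} p∤m z≤n = refl
vpAux-spec (suc fuel) q {zero} {m} p∤m _
  with 2+ q ∣? (1 * m)
... | yes d = contradiction (subst (2+ q ∣_) (*-identityˡ m) d) p∤m
... | no _ = refl
vpAux-spec (suc fuel) q {suc a} {m} p∤m (s≤s a≤)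
  with 2+ q ∣? (2+ q ^ suc a * m) | 2+ q ^ suc a * m ≟ 0
... | no ∤ | _ = contradiction (∣m⇒∣m*n m (m∣m*n (2+ q ^ a))) ∤
... | yes _ | yes ≡0 = contradiction ≡0 (≢-nonZero⁻¹ _ {{m*n≢0 (2+ q ^ suc a) m {{m^n≢0 (2+ q) (suc a)}} {{∤⇒NonZero p∤m}}}})
... | yes _ | no _ = cong suc (trans (cong (vpAux fuel q) div-step) (vpAux-spec fuel q p∤m a≤))
  where
  div-step : 2+ q ^ suc a * m / 2+ q ≡ 2+ q ^ a * m
  div-step = trans (cong (_/ 2+ q) (trans (*-assoc (2+ q) (2+ q ^ a) m) (*-comm (2+ q) (2+ q ^ a * m))))
                   (m*n/n≡m (2+ q ^ a * m) (2+ q))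

vp-spec : ∀ {p} → Prime p → ∀ a {m} → ¬ p ∣ m → vp p (p ^ a * m) ≡ a
vp-spec {zero} pr _ _ = contradiction pr ¬prime[0]
vp-spec {suc zero} pr _ _ = contradiction pr ¬prime[1]
vp-spec {2+ q} pr a {m} p∤m = vpAux-spec (2+ q ^ a * m) q p∤m
  (≤-trans (<⇒≤ (n<m^n (s≤s (s≤s z≤n)) a)) (m≤m*n _ m {{∤⇒NonZero p∤m}}))

prime>1 : ∀ {p} → Prime p → 1 < p
prime>1 pr = nonTrivial⇒n>1 _ {{prime⇒nonTrivial pr}}

split-power : ∀ {p} → Prime p → ∀ n → .{{NonZero n}} → ∃[ a ] ∃[ m ] n ≡ p ^ a * m × ¬ p ∣ m
split-power {p} pr n = <-rec (λ n → .{{NonZero n}} → ∃[ a ] ∃[ m ] n ≡ p ^ a * m × ¬ p ∣ m) step n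
  where
  instance _ = prime⇒nonTrivial pr
  step : ∀ n → (∀ {k} → k < n → .{{NonZero k}} → ∃[ a ] ∃[ m ] k ≡ p ^ a * m × ¬ p ∣ m) →
         .{{NonZero n}} → ∃[ a ] ∃[ m ] n ≡ p ^ a * m × ¬ p ∣ m
  step n rec with p ∣? n
  ... | no p∤n = 0 , n , sym (*-identityˡ n) , p∤n
  ... | yes p∣n with rec (quotient-< p∣n) {{quotient≢0 p∣n}}
  ...   | a , m , eq , p∤m = suc a , m ,
          trans (m∣n⇒n≡m*quotient p∣n) (trans (cong (p *_) eq) (sym (*-assoc p (p ^ a) m))) , p∤m

prime∣^ : ∀ {p} → Prime p → ∀ m n → p ∣ m ^ n → p ∣ m
prime∣^ pr m zero p∣1 = contradiction (subst Prime (∣1⇒≡1 p∣1) pr) ¬prime[1]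
prime∣^ pr m (suc n) p∣ with euclidsLemma m (m ^ n) pr p∣
... | inj₁ p∣m = p∣m
... | inj₂ p∣m^n = prime∣^ pr m n p∣m^n

prime∣prime : ∀ {p q} → Prime p → Prime q → p ∣ q → p ≡ q
prime∣prime pp pq p∣q with prime⇒irreducible pq p∣q
... | inj₁ p≡1 = contradiction (subst Prime p≡1 pp) ¬prime[1]
... | inj₂ p≡q = p≡q

vp-coprime-factor : ∀ {p r} → Prime p → Prime r → p ≢ r → ∀ f d → .{{NonZero d}} →
                    vp p (r ^ f * d) ≡ vp p d
vp-coprime-factor {p} {r} pp pr p≢r f d with split-power pp d
... | k , d′ , refl , p∤d′ = trans (cong (vp p) (swap (r ^ f) (p ^ k) d′))
      (trans (vp-spec pp k p∤) (sym (vp-spec pp k p∤d′)))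
  where
  swap : ∀ x y z → x * (y * z) ≡ y * (x * z)
  swap = solve-∀
  p∤ : ¬ p ∣ r ^ f * d′
  p∤ p∣ with euclidsLemma (r ^ f) d′ pp p∣
  ... | inj₁ p∣r^f = p≢r (prime∣prime pp pr (prime∣^ pp r f p∣r^f))
  ... | inj₂ p∣d′ = p∤d′ p∣d′

vp-∤ : ∀ {p n} → Prime p → ¬ p ∣ n → vp p n ≡ 0
vp-∤ {p} {n} pr p∤n = trans (cong (vp p) (sym (*-identityˡ n))) (vp-spec pr 0 p∤n)

-- Binary expansions

-- Leading zeros such as `dbl zero` are allowed, so an expansion is not unique; the results below
-- hold for every expansion of the exponent.
data Bits : ℕ → Set where
  zero : Bits 0
  dbl  : ∀ {a} → Bits a → Bits (2 * a)
  dbl1 : ∀ {a} → Bits a → Bits (1 + 2 * a)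

half-cases : ∀ n → ∃[ h ] (n ≡ 2 * h ⊎ n ≡ 1 + 2 * h)
half-cases zero = 0 , inj₁ refl
half-cases (suc n) with half-cases n
... | h , inj₁ refl = h , inj₂ refl
... | h , inj₂ refl = suc h , inj₁ (sym (*-suc 2 h))

bits : ∀ n → Bits n
bits = <-rec Bits step
  where
  step : ∀ n → (∀ {k} → k < n → Bits k) → Bits n
  step n rec with half-cases n
  ... | zero , inj₁ refl = zero
  ... | suc h , inj₁ refl = dbl (rec (m<m+n (suc h) (s≤s z≤n)))
  ... | h , inj₂ refl = dbl1 (rec (s≤s (m≤m+n h _)))

comps : ℕ → ∀ {a} → Bits a → List ℕ
comps r zero = []
comps r (dbl b) = comps (r * r) b
comps r (dbl1 b) = r ∷ comps (r * r) b

-- For prime `r` this is σ∞ (r ^ a). It is also used at bases 4, 16 or `p * p`: squaring the base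
-- corresponds to dropping the lowest digit of the exponent.
Σbits : ℕ → ∀ {a} → Bits a → ℕ
Σbits r b = product (map suc (comps r b))

subs : ∀ {a} → Bits a → List ℕ
subs zero = 0 ∷ []
subs (dbl b) = map (2 *_) (subs b)
subs (dbl1 b) = map (2 *_) (subs b) ++ map (λ k → 1 + 2 * k) (subs b)

even/2 : ∀ h → 2 * h / 2 ≡ h
even/2 h = trans (cong (_/ 2) (*-comm 2 h)) (m*n/n≡m h 2)

even%2 : ∀ h → 2 * h % 2 ≡ 0
even%2 h = trans (cong (_% 2) (*-comm 2 h)) (m*n%n≡0 h 2)

odd%2 : ∀ h → (1 + 2 * h) % 2 ≡ 1
odd%2 h = trans (cong (λ k → (1 + k) % 2) (*-comm 2 h)) ([m+kn]%n≡m%n 1 h 2)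

odd/2 : ∀ h → (1 + 2 * h) / 2 ≡ h
odd/2 h = trans (cong (λ k → (1 + k) / 2) (*-comm 2 h)) (trans (+-distrib-/-∣ʳ 1 {h * 2} {2} (n∣m*n h)) (m*n/n≡m h 2))

module _ (fuel : ℕ) {f e : ℕ} where
  bsa-00 : bitSubsetAux (suc fuel) (2 * f) (2 * e) ≡ bitSubsetAux fuel f e
  bsa-00 rewrite even%2 f | even/2 f | even/2 e = refl
  bsa-01 : bitSubsetAux (suc fuel) (2 * f) (1 + 2 * e) ≡ bitSubsetAux fuel f e
  bsa-01 rewrite even%2 f | even/2 f | odd/2 e = refl
  bsa-11 : bitSubsetAux (suc fuel) (1 + 2 * f) (1 + 2 * e) ≡ bitSubsetAux fuel f e
  bsa-11 rewrite odd%2 f | odd%2 e | odd/2 f | odd/2 e = refl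
  bsa-10 : bitSubsetAux (suc fuel) (1 + 2 * f) (2 * e) ≡ false
  bsa-10 rewrite odd%2 f | even%2 e = refl

bsa-zero : ∀ fuel e → bitSubsetAux fuel 0 e ≡ true
bsa-zero zero e = refl
bsa-zero (suc fuel) e = bsa-zero fuel (e / 2)

2h≤⇒h≤ : ∀ {h} fuel → 2 * h ≤ suc fuel → h ≤ fuel
2h≤⇒h≤ {zero} fuel _ = z≤n
2h≤⇒h≤ {suc h} fuel le = ≤-trans (m≤n+m (suc h) h) (≤-trans (≤-reflexive lemma) (s≤s⁻¹ le))
  where
  lemma : h + suc h ≡ h + suc (h + 0)
  lemma = cong (λ k → h + suc k) (sym (+-identityʳ h))

-- The fuel only has to outlast the digits of `f`: halving preserves `f ≤ fuel`, and when the bound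
-- reaches 0 so does `f`, whose digit set is empty.
bsa⇒∈subs : ∀ {a} (b : Bits a) fuel f → f ≤ fuel → bitSubsetAux (suc fuel) f a ≡ true → f ∈ subs b
bsa⇒∈subs zero fuel f f≤ eq with half-cases f
bsa⇒∈subs zero fuel _ f≤ eq | zero , inj₁ refl = here refl
bsa⇒∈subs zero zero _ () eq | suc h , inj₁ refl
bsa⇒∈subs zero (suc fuel) _ f≤ eq | suc h , inj₁ refl
  with bsa⇒∈subs zero fuel (suc h) (2h≤⇒h≤ fuel f≤) (trans (sym (bsa-00 (suc fuel) {suc h} {0})) eq)
... | here ()
... | there ()
bsa⇒∈subs zero fuel _ f≤ eq | h , inj₂ refl = case trans (sym eq) (bsa-10 fuel {h} {0}) of λ ()
bsa⇒∈subs (dbl b) fuel f f≤ eq with half-cases f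
bsa⇒∈subs (dbl {a} b) fuel _ f≤ eq | h , inj₂ refl = case trans (sym eq) (bsa-10 fuel {h} {a}) of λ ()
bsa⇒∈subs (dbl {a} b) zero _ f≤ eq | zero , inj₁ refl = ∈-map⁺ (2 *_) (bsa⇒∈subs b 0 0 z≤n (bsa-zero 1 a))
bsa⇒∈subs (dbl {a} b) (suc fuel) _ f≤ eq | h , inj₁ refl =
  ∈-map⁺ (2 *_) (bsa⇒∈subs b fuel h (2h≤⇒h≤ fuel f≤) (trans (sym (bsa-00 (suc fuel) {h} {a})) eq))
bsa⇒∈subs (dbl1 b) fuel f f≤ eq with half-cases f
bsa⇒∈subs (dbl1 {a} b) zero _ f≤ eq | zero , inj₁ refl = ∈-++⁺ˡ (∈-map⁺ (2 *_) (bsa⇒∈subs b 0 0 z≤n (bsa-zero 1 a)))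
bsa⇒∈subs (dbl1 {a} b) (suc fuel) _ f≤ eq | h , inj₁ refl =
  ∈-++⁺ˡ (∈-map⁺ (2 *_) (bsa⇒∈subs b fuel h (2h≤⇒h≤ fuel f≤) (trans (sym (bsa-01 (suc fuel) {h} {a})) eq)))
bsa⇒∈subs (dbl1 {a} b) (suc fuel) _ f≤ eq | h , inj₂ refl =
  ∈-++⁺ʳ (map (2 *_) (subs b)) (∈-map⁺ (λ k → 1 + 2 * k)
    (bsa⇒∈subs b fuel h (≤-trans (m≤m+n h _) (s≤s⁻¹ f≤)) (trans (sym (bsa-11 (suc fuel) {h} {a})) eq)))

∈subs⇒bsa : ∀ {a} (b : Bits a) {f} → f ∈ subs b → ∀ fuel → bitSubsetAux fuel f a ≡ true
∈subs⇒bsa b f∈ zero = refl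
∈subs⇒bsa zero (here refl) fuel = bsa-zero fuel 0
∈subs⇒bsa (dbl {a} b) f∈ (suc fuel) with ∈-map⁻ (2 *_) f∈
... | h , h∈ , refl = trans (bsa-00 fuel {h} {a}) (∈subs⇒bsa b h∈ fuel)
∈subs⇒bsa (dbl1 {a} b) f∈ (suc fuel) with ∈-++⁻ (map (2 *_) (subs b)) f∈
... | inj₁ f∈′ with ∈-map⁻ (2 *_) f∈′
...   | h , h∈ , refl = trans (bsa-01 fuel {h} {a}) (∈subs⇒bsa b h∈ fuel)
∈subs⇒bsa (dbl1 {a} b) f∈ (suc fuel) | inj₂ f∈′ with ∈-map⁻ (λ k → 1 + 2 * k) f∈′
...   | h , h∈ , refl = trans (bsa-11 fuel {h} {a}) (∈subs⇒bsa b h∈ fuel)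

bitSubset⇔∈subs : ∀ {a} (b : Bits a) {f} → T (bitSubset f a) ⇔ f ∈ subs b
bitSubset⇔∈subs b {f} = mk⇔ (λ t → bsa⇒∈subs b f f ≤-refl (Equivalence.to T-≡ t))
                            (λ f∈ → Equivalence.from T-≡ (∈subs⇒bsa b f∈ (suc f)))

subs-unique : ∀ {a} (b : Bits a) → Unique (subs b)
subs-unique zero = [] ∷ []
subs-unique (dbl b) = Uniq.map⁺ (*-cancelˡ-≡ _ _ 2) (subs-unique b)
subs-unique (dbl1 b) = Uniq.++⁺ (Uniq.map⁺ (*-cancelˡ-≡ _ _ 2) (subs-unique b))
  (Uniq.map⁺ (λ eq → *-cancelˡ-≡ _ _ 2 (suc-injective eq)) (subs-unique b))
  λ { (x∈ , y∈) → case (∈-map⁻ (2 *_) x∈ , ∈-map⁻ (λ k → 1 + 2 * k) y∈) of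
      λ { ((h , _ , eq) , (k , _ , eq′)) → even≢odd h k (trans (sym eq) eq′) } }

subs-≤ : ∀ {a} (b : Bits a) {f} → f ∈ subs b → f ≤ a
subs-≤ zero (here refl) = z≤n
subs-≤ (dbl b) f∈ with ∈-map⁻ (2 *_) f∈
... | h , h∈ , refl = *-monoʳ-≤ 2 (subs-≤ b h∈)
subs-≤ (dbl1 b) f∈ with ∈-++⁻ (map (2 *_) (subs b)) f∈
... | inj₁ f∈′ with ∈-map⁻ (2 *_) f∈′
...   | h , h∈ , refl = m≤n⇒m≤1+n (*-monoʳ-≤ 2 (subs-≤ b h∈))
subs-≤ (dbl1 b) f∈ | inj₂ f∈′ with ∈-map⁻ (λ k → 1 + 2 * k) f∈′
...   | h , h∈ , refl = s≤s (*-monoʳ-≤ 2 (subs-≤ b h∈))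

^-double : ∀ r h → r ^ (2 * h) ≡ (r * r) ^ h
^-double r h = trans (sym (^-*-assoc r 2 h)) (cong (λ x → (r * x) ^ h) (*-identityʳ r))

sum-pow-double : ∀ r fs → sum (map (r ^_) (map (2 *_) fs)) ≡ sum (map ((r * r) ^_) fs)
sum-pow-double r [] = refl
sum-pow-double r (f ∷ fs) = cong₂ _+_ (^-double r f) (sum-pow-double r fs)

sum-pow-double1 : ∀ r fs → sum (map (r ^_) (map (λ k → 1 + 2 * k) fs)) ≡ r * sum (map ((r * r) ^_) fs)
sum-pow-double1 r [] = sym (*-zeroʳ r)
sum-pow-double1 r (f ∷ fs) = trans (cong₂ _+_ (cong (r *_) (^-double r f)) (sum-pow-double1 r fs))
                                   (sym (*-distribˡ-+ r _ _))

-- This expands the product of the `1 + r ^ 2 ^ j`: at a digit 1 of the exponent, the lowest digit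
-- of the chosen `f` contributes 1 or `r`, and the remaining digits contribute powers of `r * r`.
sum-pow-subs : ∀ r {a} (b : Bits a) → sum (map (r ^_) (subs b)) ≡ Σbits r b
sum-pow-subs r zero = refl
sum-pow-subs r (dbl b) = trans (sum-pow-double r (subs b)) (sum-pow-subs (r * r) b)
sum-pow-subs r (dbl1 b) = begin
  sum (map (r ^_) (map (2 *_) ss ++ map (λ k → 1 + 2 * k) ss))
    ≡⟨ cong sum (map-++ (r ^_) (map (2 *_) ss) _) ⟩
  sum (map (r ^_) (map (2 *_) ss) ++ map (r ^_) (map (λ k → 1 + 2 * k) ss))
    ≡⟨ sum-++ (map (r ^_) (map (2 *_) ss)) _ ⟩
  sum (map (r ^_) (map (2 *_) ss)) + sum (map (r ^_) (map (λ k → 1 + 2 * k) ss))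
    ≡⟨ cong₂ _+_ (sum-pow-double r ss) (sum-pow-double1 r ss) ⟩
  suc r * sum (map ((r * r) ^_) ss)
    ≡⟨ cong (suc r *_) (sum-pow-subs (r * r) b) ⟩
  suc r * Σbits (r * r) b ∎
  where
  open ≡-Reasoning
  ss = subs b

-- Infinitary divisors of `r ^ a * m` and multiplicativity of σ∞.

infDivs : ℕ → List ℕ
infDivs n = filter (λ d → T? (isInfDiv d n)) (upTo (suc n))

-- All primes are quantified over, unlike in `isInfDiv`; for primes above `n` both valuations
-- vanish, so the two conditions agree.
_InfDiv_ : ℕ → ℕ → Set
d InfDiv n = d ∣ n × (∀ {p} → Prime p → T (bitSubset (vp p d) (vp p n)))

T-and-map : ∀ {A : Set} (f : A → Bool) xs → T (and (map f xs)) ⇔ (∀ {x} → x ∈ xs → T (f x))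
T-and-map f [] = mk⇔ (λ _ ()) (λ _ → tt)
T-and-map f (x ∷ xs) = mk⇔ to from
  where
  to : T (f x ∧ and (map f xs)) → ∀ {y} → y ∈ x ∷ xs → T (f y)
  to t (here refl) = proj₁ (Equivalence.to T-∧ t)
  to t (there y∈) = Equivalence.to (T-and-map f xs) (proj₂ (Equivalence.to T-∧ t)) y∈
  from : (∀ {y} → y ∈ x ∷ xs → T (f y)) → T (f x ∧ and (map f xs))
  from h = Equivalence.from T-∧ (h (here refl) , Equivalence.from (T-and-map f xs) (h ∘ there))

∈-infDivs : ∀ {n d} → .{{NonZero n}} → d ∈ infDivs n ⇔ d InfDiv n
∈-infDivs {n} {d} = mk⇔ to from
  where
  Q : ℕ → Bool
  Q p = bitSubset (vp p d) (vp p n)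
  to : d ∈ infDivs n → d InfDiv n
  to d∈ with ∈-filter⁻ (λ d → T? (isInfDiv d n)) {xs = upTo (suc n)} d∈
  ... | _ , t with Equivalence.to (T-∧ {⌊ d ∣? n ⌋}) t
  ...   | t₁ , t₂ with toWitness t₁ | proj₂ (Equivalence.to (T-∧ {not ⌊ d ≟ 0 ⌋}) t₂)
  ...     | d∣n | t₃ = d∣n , λ {p} pr → bit {p} pr
    where
    bit : ∀ {p} → Prime p → T (Q p)
    bit {p} pr with p ≤? n
    ... | yes p≤n = Equivalence.to (T-and-map Q (primesUpTo n)) t₃
                      (∈-filter⁺ prime? (∈-upTo⁺ (s≤s p≤n)) pr)
    ... | no p≰n rewrite vp-∤ pr (λ p∣n → p≰n (∣⇒≤ p∣n))
                       | vp-∤ pr (λ p∣d → p≰n (∣⇒≤ (∣-trans p∣d d∣n))) = tt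
  from : d InfDiv n → d ∈ infDivs n
  from (d∣n , bit) = ∈-filter⁺ (λ d → T? (isInfDiv d n)) (∈-upTo⁺ (s≤s (∣⇒≤ d∣n)))
    (Equivalence.from (T-∧ {⌊ d ∣? n ⌋}) (fromWitness d∣n , Equivalence.from T-∧ (d≢0 , Equivalence.from (T-and-map Q (primesUpTo n))
       λ {p} p∈ → bit (proj₂ (∈-filter⁻ prime? {xs = upTo (suc n)} p∈)))))
    where
    d≢0 : T (not ⌊ d ≟ 0 ⌋)
    d≢0 with d ≟ 0
    ... | yes refl = ≢-nonZero⁻¹ n (0∣⇒≡0 d∣n)
    ... | no _ = tt

infDivs-unique : ∀ n → Unique (infDivs n)
infDivs-unique n = Uniq.filter⁺ (λ d → T? (isInfDiv d n)) (Uniq.upTo⁺ (suc n))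

products : ℕ → List ℕ → List ℕ → List ℕ
products r = cartesianProductWith (λ f d → r ^ f * d)

sum-map-* : ∀ c ds → sum (map (c *_) ds) ≡ c * sum ds
sum-map-* c [] = sym (*-zeroʳ c)
sum-map-* c (d ∷ ds) = trans (cong (c * d +_) (sum-map-* c ds)) (sym (*-distribˡ-+ c d (sum ds)))

sum-products : ∀ r fs ds → sum (products r fs ds) ≡ sum (map (r ^_) fs) * sum ds
sum-products r [] ds = refl
sum-products r (f ∷ fs) ds = begin
  sum (map (r ^ f *_) ds ++ products r fs ds)          ≡⟨ sum-++ (map (r ^ f *_) ds) _ ⟩
  sum (map (r ^ f *_) ds) + sum (products r fs ds)     ≡⟨ cong₂ _+_ (sum-map-* (r ^ f) ds) (sum-products r fs ds) ⟩
  r ^ f * sum ds + sum (map (r ^_) fs) * sum ds        ≡⟨ *-distribʳ-+ (sum ds) (r ^ f) _ ⟨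
  (r ^ f + sum (map (r ^_) fs)) * sum ds               ∎
  where open ≡-Reasoning

module _ {r} (pr : Prime r) where
  private instance
    r≢0 : NonZero r
    r≢0 = prime⇒nonZero pr

  power-part : ∀ {f f′ d d′} → ¬ r ∣ d → ¬ r ∣ d′ → r ^ f * d ≡ r ^ f′ * d′ → f ≡ f′
  power-part {f} {f′} r∤d r∤d′ eq = trans (sym (vp-spec pr f r∤d)) (trans (cong (vp r) eq) (vp-spec pr f′ r∤d′))

  products-unique : ∀ {fs ds} → Unique fs → Unique ds → (∀ {d} → d ∈ ds → ¬ r ∣ d) → Unique (products r fs ds)
  products-unique [] ud r∤ = []
  products-unique {f ∷ fs} {ds} (f∉ ∷ uf) ud r∤ = Uniq.++⁺
    (Uniq.map⁺ (*-cancelˡ-≡ _ _ (r ^ f) {{m^n≢0 r f}}) ud) (products-unique uf ud r∤) disjoint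
    where
    disjoint : ∀ {x} → ¬ (x ∈ map (r ^ f *_) ds × x ∈ products r fs ds)
    disjoint (x∈ , x∈′) with ∈-map⁻ (r ^ f *_) x∈ | ∈-cartesianProductWith⁻ (λ f d → r ^ f * d) fs ds x∈′
    ... | d , d∈ , refl | f′ , d′ , f′∈ , d′∈ , eq = All.lookup f∉ f′∈ (power-part (r∤ d∈) (r∤ d′∈) eq)

  ∤⇒coprime : ∀ {d} → ¬ r ∣ d → Coprime d r
  ∤⇒coprime r∤d (k∣d , k∣r) with prime⇒irreducible pr k∣r
  ... | inj₁ k≡1 = k≡1
  ... | inj₂ refl = contradiction k∣d r∤d

  ∤∣^* : ∀ a {d m} → ¬ r ∣ d → d ∣ r ^ a * m → d ∣ m
  ∤∣^* zero {d} {m} r∤d dv = subst (d ∣_) (*-identityˡ m) dv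
  ∤∣^* (suc a) {d} {m} r∤d dv = ∤∣^* a r∤d
    (coprime-divisor (∤⇒coprime r∤d) (subst (d ∣_) (*-assoc r (r ^ a) m) dv))

  -- The lists are ordered differently, but both are free of duplicates and have the same members,
  -- hence are permutations of each other.
  infDivs-^* : ∀ {a} (b : Bits a) {m} → ¬ r ∣ m → infDivs (r ^ a * m) ↭ products r (subs b) (infDivs m)
  infDivs-^* {a} b {m} r∤m = ∼bag⇒↭ (unique∧set⇒bag (infDivs-unique (r ^ a * m))
      (products-unique (subs-unique b) (infDivs-unique m) r∤div) (mk⇔ to from))
    where
    instance
      m≢0 : NonZero m
      m≢0 = ∤⇒NonZero r∤m
      n≢0 : NonZero (r ^ a * m)
      n≢0 = m*n≢0 (r ^ a) m {{m^n≢0 r a}}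
    r∤div : ∀ {d} → d ∈ infDivs m → ¬ r ∣ d
    r∤div d∈ r∣d = r∤m (∣-trans r∣d (proj₁ (Equivalence.to ∈-infDivs d∈)))
    to : ∀ {x} → x ∈ infDivs (r ^ a * m) → x ∈ products r (subs b) (infDivs m)
    to {x} x∈ with Equivalence.to (∈-infDivs {r ^ a * m}) x∈
    ... | x∣n , bit with split-power pr x {{≢-nonZero λ { refl → ≢-nonZero⁻¹ (r ^ a * m) (0∣⇒≡0 x∣n) }}}
    ...   | f , d , refl , r∤d = ∈-cartesianProductWith⁺ (λ f d → r ^ f * d) f∈ (Equivalence.from ∈-infDivs (d∣m , bit′))
      where
      instance
        d≢0 : NonZero d
        d≢0 = ∤⇒NonZero r∤d
      d∣m : d ∣ m
      d∣m = ∤∣^* a r∤d (∣-trans (n∣m*n (r ^ f)) x∣n)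
      f∈ : f ∈ subs b
      f∈ = Equivalence.to (bitSubset⇔∈subs b) (subst T (cong₂ bitSubset (vp-spec pr f r∤d) (vp-spec pr a r∤m)) (bit pr))
      bit′ : ∀ {p} → Prime p → T (bitSubset (vp p d) (vp p m))
      bit′ {p} pp with p ≟ r
      ... | yes refl rewrite vp-∤ pp r∤d = tt
      ... | no p≢r = subst T (cong₂ bitSubset (vp-coprime-factor pp pr p≢r f d) (vp-coprime-factor pp pr p≢r a m)) (bit pp)
    from : ∀ {x} → x ∈ products r (subs b) (infDivs m) → x ∈ infDivs (r ^ a * m)
    from x∈ with ∈-cartesianProductWith⁻ (λ f d → r ^ f * d) (subs b) (infDivs m) x∈
    ... | f , d , f∈ , d∈ , refl with Equivalence.to (∈-infDivs {m}) d∈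
    ...   | d∣m , bit = Equivalence.from ∈-infDivs (*-pres-∣ (m^n∣m^o (subs-≤ b f∈)) d∣m , bit′)
      where
      instance
        d≢0 : NonZero d
        d≢0 = ≢-nonZero λ { refl → ≢-nonZero⁻¹ m (0∣⇒≡0 d∣m) }
      m^n∣m^o : ∀ {f a} → f ≤ a → r ^ f ∣ r ^ a
      m^n∣m^o {f} {a} f≤a = divides (r ^ (a ∸ f)) (trans (cong (r ^_) (sym (m∸n+n≡m f≤a))) (^-distribˡ-+-* r (a ∸ f) f))
      bit′ : ∀ {p} → Prime p → T (bitSubset (vp p (r ^ f * d)) (vp p (r ^ a * m)))
      bit′ {p} pp with p ≟ r
      ... | yes refl = subst T (sym (cong₂ bitSubset (vp-spec pr f (r∤div d∈)) (vp-spec pr a r∤m)))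
                         (Equivalence.from (bitSubset⇔∈subs b) f∈)
      ... | no p≢r = subst T (sym (cong₂ bitSubset (vp-coprime-factor pp pr p≢r f d) (vp-coprime-factor pp pr p≢r a m))) (bit pp)

  σ∞-^* : ∀ {a} (b : Bits a) {m} → ¬ r ∣ m → σ∞ (r ^ a * m) ≡ Σbits r b * σ∞ m
  σ∞-^* b {m} r∤m = trans (sum-↭ (infDivs-^* b r∤m))
    (trans (sum-products r (subs b) (infDivs m)) (cong (_* σ∞ m) (sum-pow-subs r b)))

-- Decomposition of a number into components.

prime-divisor : ∀ n → 1 < n → ∃[ r ] Prime r × r ∣ n
prime-divisor n@(suc _) 1<n with factorise n
... | record { factors = [] ; isFactorisation = eq } = contradiction eq (>⇒≢ 1<n)
... | record { factors = r ∷ rs ; isFactorisation = eq ; factorsPrime = pr ∷ _ } =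
  r , pr , subst (r ∣_) (sym eq) (m∣m*n (product rs))

no-prime-divisor⇒1 : ∀ {n} → .{{NonZero n}} → (∀ {r} → Prime r → ¬ r ∣ n) → n ≡ 1
no-prime-divisor⇒1 {suc zero} h = refl
no-prime-divisor⇒1 {2+ n} h with prime-divisor (2+ n) (s≤s (s≤s z≤n))
... | r , pr , r∣n = contradiction r∣n (h pr)

IsComp : ℕ → Set
IsComp q = ∃[ r ] ∃[ l ] Prime r × q ≡ r ^ (2 ^ l)

^-double-* : ∀ r n → r ^ (2 * n) ≡ r ^ n * r ^ n
^-double-* r n = trans (cong (λ k → r ^ (n + k)) (+-identityʳ n)) (^-distribˡ-+-* r n n)

comps-form : ∀ {s r} k → s ≡ r ^ (2 ^ k) → ∀ {a} (b : Bits a) {q} → q ∈ comps s b → ∃[ l ] k ≤ l × q ≡ r ^ (2 ^ l)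
comps-form {s} {r} k refl (dbl b) q∈ with comps-form (suc k) (sym (^-double-* r (2 ^ k))) b q∈
... | l , k≤l , eq = l , ≤-trans (n≤1+n k) k≤l , eq
comps-form {s} {r} k refl (dbl1 b) (here refl) = k , ≤-refl , refl
comps-form {s} {r} k refl (dbl1 b) (there q∈) with comps-form (suc k) (sym (^-double-* r (2 ^ k))) b q∈
... | l , k≤l , eq = l , ≤-trans (n≤1+n k) k≤l , eq

product-comps : ∀ s {a} (b : Bits a) → product (comps s b) ≡ s ^ a
product-comps s zero = refl
product-comps s (dbl {a} b) = trans (product-comps (s * s) b) (sym (^-double s a))
product-comps s (dbl1 {a} b) = cong (s *_) (trans (product-comps (s * s) b) (sym (^-double s a)))

s<s*s : ∀ {s} → 1 < s → s < s * s
s<s*s {s@(suc _)} 1<s = m<m*n s s 1<s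

comps≥ : ∀ {s} → 1 < s → ∀ {a} (b : Bits a) {q} → q ∈ comps s b → s ≤ q
comps≥ 1<s (dbl b) q∈ = <⇒≤ (<-≤-trans (s<s*s 1<s) (comps≥ (<-trans 1<s (s<s*s 1<s)) b q∈))
comps≥ 1<s (dbl1 b) (here refl) = ≤-refl
comps≥ 1<s (dbl1 b) (there q∈) = <⇒≤ (<-≤-trans (s<s*s 1<s) (comps≥ (<-trans 1<s (s<s*s 1<s)) b q∈))

comps-unique : ∀ {s} → 1 < s → ∀ {a} (b : Bits a) → Unique (comps s b)
comps-unique 1<s zero = []
comps-unique 1<s (dbl b) = comps-unique (<-trans 1<s (s<s*s 1<s)) b
comps-unique {s} 1<s (dbl1 b) =
  All.tabulate (λ q∈ → <⇒≢ (<-≤-trans (s<s*s 1<s) (comps≥ (<-trans 1<s (s<s*s 1<s)) b q∈)))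
  ∷ comps-unique (<-trans 1<s (s<s*s 1<s)) b

record Decomposition (n : ℕ) : Set where
  constructor decomposition
  field
    parts   : List ℕ
    unique  : Unique parts
    isComp  : ∀ {q} → q ∈ parts → IsComp q
    product≡ : product parts ≡ n
    σ≡      : product (map suc parts) ≡ σ∞ n

n∣n^ : ∀ r n → .{{NonZero n}} → r ∣ r ^ n
n∣n^ r (suc n) = m∣m*n (r ^ n)

decompose : ∀ n → .{{NonZero n}} → Decomposition n
decompose n = <-rec (λ n → .{{NonZero n}} → Decomposition n) step n
  where
  step : ∀ n → (∀ {k} → k < n → .{{NonZero k}} → Decomposition k) → .{{NonZero n}} → Decomposition n
  step (suc zero) rec = decomposition [] [] (λ ()) refl refl
  step (2+ n) rec with prime-divisor (2+ n) (s≤s (s≤s z≤n))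
  ... | r , pr , r∣n with split-power pr (2+ n)
  ...   | zero , m , eq , r∤m = contradiction (subst (r ∣_) (trans eq (*-identityˡ m)) r∣n) r∤m
  ...   | a@(suc _) , m , eq , r∤m = decomposition (comps r b ++ parts) unique′ isComp′ product′ σ′
    where
    b : Bits a
    b = bits a
    1<r : 1 < r
    1<r = prime>1 pr
    instance
      m≢0 : NonZero m
      m≢0 = ∤⇒NonZero r∤m
    m<n : m < 2+ n
    m<n = subst (m <_) (trans (*-comm m (r ^ a)) (sym eq)) (m<m*n m (r ^ a) (≤-trans (s≤s (s≤s z≤n)) (n<m^n 1<r a)))
    open Decomposition (rec m<n)
    isComp′ : ∀ {q} → q ∈ comps r b ++ parts → IsComp q
    isComp′ q∈ with ∈-++⁻ (comps r b) q∈
    ... | inj₂ q∈′ = isComp q∈′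
    ... | inj₁ q∈′ with comps-form {r = r} 0 (sym (*-identityʳ r)) b q∈′
    ...   | l , _ , eq′ = r , l , pr , eq′
    unique′ : Unique (comps r b ++ parts)
    unique′ = Uniq.++⁺ (comps-unique 1<r b) unique disjoint
      where
      disjoint : ∀ {x} → ¬ (x ∈ comps r b × x ∈ parts)
      disjoint (x∈ , x∈′) with comps-form {r = r} 0 (sym (*-identityʳ r)) b x∈
      ... | l , _ , refl = r∤m (∣-trans (n∣n^ r (2 ^ l) {{m^n≢0 2 l}}) (subst (_ ∣_) product≡ (∈⇒∣product x∈′)))
    product′ : product (comps r b ++ parts) ≡ 2+ n
    product′ = trans (product-++ (comps r b) parts) (trans (cong₂ _*_ (product-comps r b) product≡) (sym eq))
    σ′ : product (map suc (comps r b ++ parts)) ≡ σ∞ (2+ n)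
    σ′ = trans (cong product (map-++ suc (comps r b) parts)) (trans (product-++ (map suc (comps r b)) _)
           (trans (cong (Σbits r b *_) σ≡) (trans (sym (σ∞-^* pr b r∤m)) (cong σ∞ (sym eq)))))

-- Quadratic residues by descent

mul-mod : ∀ n → .{{_ : NonZero n}} → ∀ a b {c d} → a % n ≡ c → b % n ≡ d → (a * b) % n ≡ (c * d) % n
mul-mod n a b refl refl = %-distribˡ-* a b n

add-mod : ∀ n → .{{_ : NonZero n}} → ∀ a b {c d} → a % n ≡ c → b % n ≡ d → (a + b) % n ≡ (c + d) % n
add-mod n a b refl refl = %-distribˡ-+ a b n

square-mod-complement : ∀ n → .{{_ : NonZero n}} → ∀ z w → z + w ≡ n → (w * w) % n ≡ (z * z) % n
square-mod-complement n z w refl = trans (sym ([m+kn]%n≡m%n (w * w) z n))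
  (trans (cong (_% n) (lemma z w)) ([m+kn]%n≡m%n (z * z) w n))
  where
  lemma : ∀ z w → w * w + z * (z + w) ≡ z * z + w * (z + w)
  lemma = solve-∀

odd+odd : ∀ h k → (1 + 2 * h) + (1 + 2 * k) ≡ 2 * (1 + h + k)
odd+odd = solve-∀

even+even : ∀ h k → 2 * h + 2 * k ≡ 2 * (h + k)
even+even = solve-∀

-- The residue of `y` and its complement in `n` have the same square and, as `n` is odd, opposite
-- parity. The descents below use the even one to get `z² + 1 ≡ 1 mod 4` and the odd one to get
-- `z² ≡ 1 mod 8`.
parity-representatives : ∀ k y → let n = 1 + 2 * k in
  ∃[ h ] ∃[ j ] 2 * h ≤ n × 1 + 2 * j ≤ n × (2 * h * (2 * h)) % n ≡ (y * y) % n × ((1 + 2 * j) * (1 + 2 * j)) % n ≡ (y * y) % n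
parity-representatives k y = go (half-cases z) (half-cases w)
  where
  n z w : ℕ
  n = 1 + 2 * k
  z = y % n
  w = n ∸ z
  z≤n′ : z ≤ n
  z≤n′ = <⇒≤ (m%n<n y n)
  z+w : z + w ≡ n
  z+w = m+[n∸m]≡n z≤n′
  z²≡ : (z * z) % n ≡ (y * y) % n
  z²≡ = sym (%-distribˡ-* y y n)
  w²≡ : (w * w) % n ≡ (y * y) % n
  w²≡ = trans (square-mod-complement n z w z+w) z²≡
  go : ∃[ h ] (z ≡ 2 * h ⊎ z ≡ 1 + 2 * h) → ∃[ h ] (w ≡ 2 * h ⊎ w ≡ 1 + 2 * h) → _
  go (h , inj₁ z≡) (j , inj₂ w≡) = h , j , subst (_≤ n) z≡ z≤n′ , subst (_≤ n) w≡ (m∸n≤m n z) ,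
    subst (λ z → (z * z) % n ≡ (y * y) % n) z≡ z²≡ , subst (λ z → (z * z) % n ≡ (y * y) % n) w≡ w²≡
  go (h , inj₂ z≡) (j , inj₁ w≡) = j , h , subst (_≤ n) w≡ (m∸n≤m n z) , subst (_≤ n) z≡ z≤n′ ,
    subst (λ z → (z * z) % n ≡ (y * y) % n) w≡ w²≡ , subst (λ z → (z * z) % n ≡ (y * y) % n) z≡ z²≡
  go (h , inj₁ z≡) (j , inj₁ w≡) = ⊥-elim (even≢odd (h + j) k (trans (sym (even+even h j)) (trans (sym (cong₂ _+_ z≡ w≡)) z+w)))
  go (h , inj₂ z≡) (j , inj₂ w≡) = ⊥-elim (even≢odd (1 + h + j) k (trans (sym (odd+odd h j)) (trans (sym (cong₂ _+_ z≡ w≡)) z+w)))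

odd-view : ∀ n → n % 2 ≡ 1 → ∃[ k ] n ≡ 1 + 2 * k
odd-view n odd with half-cases n
... | k , inj₂ refl = k , refl
... | k , inj₁ refl = case trans (sym (even%2 k)) odd of λ ()

%-% : ∀ d e → .{{_ : NonZero d}} → .{{_ : NonZero e}} → d ∣ e → ∀ n {c} → n % e ≡ c → n % d ≡ c % d
%-% d e d∣e n eq = trans (sym (m∣n⇒o%n%m≡o%m d e n d∣e)) (cong (_% d) eq)

-- Descent: with an even representative `z < n`, the cofactor `m` in `z² + 1 = m n` is smaller than
-- `n`, again 3 mod 4, and again divides `z² + 1`. No primality is involved.
3mod4∤y²+1 : ∀ n → n % 4 ≡ 3 → ∀ y → ¬ n ∣ y * y + 1
3mod4∤y²+1 = <-rec (λ n → n % 4 ≡ 3 → ∀ y → ¬ n ∣ y * y + 1) step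
  where
  cases : ∀ {c} → c < 4 → (3 * c) % 4 ≡ 1 → c ≡ 3
  cases = toWitness {a? = allUpTo? (λ c → ((3 * c) % 4 ≟ 1) →-dec (c ≟ 3)) 4} tt
  step : ∀ n → (∀ {k} → k < n → k % 4 ≡ 3 → ∀ y → ¬ k ∣ y * y + 1) → n % 4 ≡ 3 → ∀ y → ¬ n ∣ y * y + 1
  step n rec n%4 y n∣ with odd-view n (%-% 2 4 (divides 2 refl) n n%4)
  ... | k , refl with parity-representatives k y
  ...   | h , _ , 2h≤n , _ , z²≡ , _ = rec m<n m%4 z (subst (m ∣_) (sym z²+1≡) (m∣m*n n))
    where
    z m : ℕ
    z = 2 * h
    n∣z²+1 : n ∣ z * z + 1
    n∣z²+1 = m%n≡0⇒n∣m _ n (trans (add-mod n (z * z) 1 z²≡ refl)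
      (trans (sym (%-distribˡ-+ (y * y) 1 n)) (n∣m⇒m%n≡0 (y * y + 1) n n∣)))
    m = quotient n∣z²+1
    z²+1≡ : z * z + 1 ≡ m * n
    z²+1≡ = m∣n⇒n≡quotient*m n∣z²+1
    z<n : z < n
    z<n = ≤∧≢⇒< 2h≤n (even≢odd h k)
    m%4 : m % 4 ≡ 3
    m%4 = cases (m%n<n m 4) (trans (sym (mul-mod 4 n m n%4 refl))
      (trans (cong (_% 4) (trans (*-comm n m) (sym z²+1≡)))
       (trans (cong (_% 4) (lemma h)) ([m+kn]%n≡m%n 1 (h * h) 4))))
      where
      lemma : ∀ h → 2 * h * (2 * h) + 1 ≡ 1 + h * h * 4
      lemma = solve-∀
    1<n : 1 < n
    1<n = ≤-trans (s≤s (s≤s z≤n)) (subst (_≤ n) n%4 (m%n≤m n 4))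
    m<n : m < n
    m<n = *-cancelʳ-< n m n (begin-strict
      m * n           ≡⟨ z²+1≡ ⟨
      z * z + 1       ≤⟨ +-monoˡ-≤ 1 (*-monoʳ-≤ z (<⇒≤ z<n)) ⟩
      z * n + 1       <⟨ +-monoʳ-< (z * n) 1<n ⟩
      z * n + n       ≡⟨ +-comm (z * n) n ⟩
      suc z * n       ≤⟨ *-monoˡ-≤ n z<n ⟩
      n * n           ∎)
      where open ≤-Reasoning

odd²%8 : ∀ j → ((1 + 2 * j) * (1 + 2 * j)) % 8 ≡ 1
odd²%8 j with half-cases j
... | h , inj₁ refl = trans (cong (_% 8) (lemma h)) ([m+kn]%n≡m%n 1 (h + 2 * (h * h)) 8)
  where
  lemma : ∀ h → (1 + 2 * (2 * h)) * (1 + 2 * (2 * h)) ≡ 1 + (h + 2 * (h * h)) * 8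
  lemma = solve-∀
... | h , inj₂ refl = trans (cong (_% 8) (lemma h)) ([m+kn]%n≡m%n 1 (1 + 3 * h + 2 * (h * h)) 8)
  where
  lemma : ∀ h → (1 + 2 * (1 + 2 * h)) * (1 + 2 * (1 + 2 * h)) ≡ 1 + (1 + 3 * h + 2 * (h * h)) * 8
  lemma = solve-∀

-- Descent: an odd representative `z` gives `z² = 2 + m n` with `m < n` and `m n ≡ 7 mod 8`. Passing
-- from `n` to `m` exchanges the residues 3 and 5, so both are treated together.
±3mod8⇒x²≢2 : ∀ n → .{{_ : NonZero n}} → n % 8 ≡ 3 ⊎ n % 8 ≡ 5 → ∀ x → ¬ (x * x) % n ≡ 2
±3mod8⇒x²≢2 n = <-rec (λ n → .{{_ : NonZero n}} → n % 8 ≡ 3 ⊎ n % 8 ≡ 5 → ∀ x → ¬ (x * x) % n ≡ 2) step n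
  where
  swap-residue : ∀ {m n} → n % 8 ≡ 3 ⊎ n % 8 ≡ 5 → (2 + m * n) % 8 ≡ 1 → m % 8 ≡ 3 ⊎ m % 8 ≡ 5
  swap-residue {m} {n} (inj₁ n%8) eq = inj₂ (toWitness {a? = allUpTo? (λ c → ((2 + (c * 3) % 8) % 8 ≟ 1) →-dec (c ≟ 5)) 8} tt
    (m%n<n m 8) (trans (sym (add-mod 8 2 (m * n) refl (mul-mod 8 m n refl n%8))) eq))
  swap-residue {m} {n} (inj₂ n%8) eq = inj₁ (toWitness {a? = allUpTo? (λ c → ((2 + (c * 5) % 8) % 8 ≟ 1) →-dec (c ≟ 3)) 8} tt
    (m%n<n m 8) (trans (sym (add-mod 8 2 (m * n) refl (mul-mod 8 m n refl n%8))) eq))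
  odd : ∀ {n} → n % 8 ≡ 3 ⊎ n % 8 ≡ 5 → n % 2 ≡ 1
  odd {n} (inj₁ e) = %-% 2 8 (divides 4 refl) n e
  odd {n} (inj₂ e) = %-% 2 8 (divides 4 refl) n e
  step : ∀ n → (∀ {k} → k < n → .{{_ : NonZero k}} → k % 8 ≡ 3 ⊎ k % 8 ≡ 5 → ∀ x → ¬ (x * x) % k ≡ 2) →
         .{{_ : NonZero n}} → n % 8 ≡ 3 ⊎ n % 8 ≡ 5 → ∀ x → ¬ (x * x) % n ≡ 2
  step n rec n%8 y y²≡2 with odd-view n (odd {n} n%8)
  ... | k , refl with parity-representatives k y
  ...   | _ , j , _ , z≤n′ , _ , z²≡ = rec m<n m%8 z z²%m
    where
    z m : ℕ
    z = 1 + 2 * j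
    m = z * z / n
    z²≡2+ : z * z ≡ 2 + m * n
    z²≡2+ = trans (m≡m%n+[m/n]*n (z * z) n) (cong (_+ m * n) (trans z²≡ y²≡2))
    m%8 : m % 8 ≡ 3 ⊎ m % 8 ≡ 5
    m%8 = swap-residue {m} {n} n%8 (trans (cong (_% 8) (sym z²≡2+)) (odd²%8 j))
    m<n : m < n
    m<n = *-cancelʳ-< n m n (begin-strict
      m * n       <⟨ m<n+m (m * n) (s≤s z≤n) ⟩
      2 + m * n   ≡⟨ z²≡2+ ⟨
      z * z       ≤⟨ *-mono-≤ z≤n′ z≤n′ ⟩
      n * n       ∎)
      where open ≤-Reasoning
    3≤m : ∀ {m} → m % 8 ≡ 3 ⊎ m % 8 ≡ 5 → 2 < m
    3≤m {m} (inj₁ e) = subst (_≤ m) e (m%n≤m m 8)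
    3≤m {m} (inj₂ e) = ≤-trans (s≤s (s≤s (s≤s z≤n))) (subst (_≤ m) e (m%n≤m m 8))
    instance
      m≢0 : NonZero m
      m≢0 = >-nonZero (≤-trans (s≤s z≤n) (3≤m {m} m%8))
    z²%m : (z * z) % m ≡ 2
    z²%m = trans (cong (_% m) (trans z²≡2+ (cong (2 +_) (*-comm m n))))
             (trans ([m+kn]%n≡m%n 2 n m) (m<n⇒m%n≡m (3≤m {m} m%8)))

-- If y⁴ ≡ −1 modulo n then (y³ − y)² ≡ 2.
5mod8∤y⁴+1 : ∀ n → n % 8 ≡ 5 → ∀ y → ¬ n ∣ y * y * (y * y) + 1
5mod8∤y⁴+1 n n%8 zero n∣1 = case subst (λ n → n % 8 ≡ 5) (∣1⇒≡1 n∣1) n%8 of λ ()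
5mod8∤y⁴+1 n n%8 1 n∣2 = case ≤-trans (subst (_≤ n) n%8 (m%n≤m n 8)) (∣⇒≤ n∣2) of λ { (s≤s (s≤s ())) }
5mod8∤y⁴+1 n n%8 y@(2+ t) n∣ = ±3mod8⇒x²≢2 n (inj₂ n%8) (y * (1 + u)) (trans (cong (_% n) x²≡)
    (trans (add-mod n 2 _ (m<n⇒m%n≡m 2<n) (n∣m⇒m%n≡0 ((y * y * (y * y) + 1) * u) n (∣m⇒∣m*n u n∣)))
      (m<n⇒m%n≡m 2<n)))
  where
  -- `u` is y² - 2, so that y (1 + u) = y³ - y and (y³ - y)² = 2 + (y⁴ + 1) u; it is a natural
  -- number because y ≥ 2.
  u : ℕ
  u = 2 + 4 * t + t * t
  2<n : 2 < n
  2<n = ≤-trans (s≤s (s≤s (s≤s z≤n))) (subst (_≤ n) n%8 (m%n≤m n 8))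
  instance
    n≢0 : NonZero n
    n≢0 = >-nonZero (≤-trans (s≤s z≤n) 2<n)
  x²≡ : y * (1 + u) * (y * (1 + u)) ≡ 2 + (y * y * (y * y) + 1) * u
  x²≡ = lemma t
    where
    lemma : ∀ t → (2 + t) * (1 + (2 + 4 * t + t * t)) * ((2 + t) * (1 + (2 + 4 * t + t * t)))
                ≡ 2 + ((2 + t) * (2 + t) * ((2 + t) * (2 + t)) + 1) * (2 + 4 * t + t * t)
    lemma = solve-∀

-- Prime divisors of the factors `1 + x ^ 2 ^ l`.

prime∣product : ∀ {r} → Prime r → ∀ L → r ∣ product L → ∃[ q ] q ∈ L × r ∣ q
prime∣product pr [] r∣1 = contradiction (subst Prime (∣1⇒≡1 r∣1) pr) ¬prime[1]
prime∣product pr (q ∷ L) r∣ with euclidsLemma q (product L) pr r∣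
... | inj₁ r∣q = q , here refl , r∣q
... | inj₂ r∣L with prime∣product pr L r∣L
...   | q′ , q′∈ , r∣q′ = q′ , there q′∈ , r∣q′

prime∣Σbits : ∀ {r} → Prime r → ∀ s {a} (b : Bits a) → r ∣ Σbits s b → ∃[ l ] r ∣ suc (s ^ (2 ^ l))
prime∣Σbits {r} pr s b r∣ with prime∣product pr (map suc (comps s b)) r∣
... | q′ , q′∈ , r∣q′ with ∈-map⁻ suc q′∈
...   | q , q∈ , refl with comps-form {r = s} 0 (sym (*-identityʳ s)) b q∈
...     | l , _ , refl = l , r∣q′

square-^ : ∀ x n → (x * x) ^ n ≡ x ^ n * x ^ n
square-^ x n = trans (sym (^-double x n)) (^-double-* x n)

prime∣Σbits-² : ∀ {r} → Prime r → ∀ x {a} (b : Bits a) → r ∣ Σbits (x * x) b → ∃[ y ] r ∣ y * y + 1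
prime∣Σbits-² {r} pr x b r∣ with prime∣Σbits pr (x * x) b r∣
... | l , d = x ^ (2 ^ l) , subst (r ∣_) (trans (cong suc (square-^ x (2 ^ l))) (+-comm 1 _)) d

prime∣Σbits-⁴ : ∀ {r} → Prime r → ∀ x {a} (b : Bits a) → r ∣ Σbits (x * x * (x * x)) b → ∃[ y ] r ∣ y * y * (y * y) + 1
prime∣Σbits-⁴ {r} pr x b r∣ with prime∣Σbits pr (x * x * (x * x)) b r∣
... | l , d = x ^ (2 ^ l) , subst (r ∣_) (trans (cong suc eq) (+-comm 1 _)) d
  where
  eq : (x * x * (x * x)) ^ (2 ^ l) ≡ x ^ (2 ^ l) * x ^ (2 ^ l) * (x ^ (2 ^ l) * x ^ (2 ^ l))
  eq = trans (square-^ (x * x) (2 ^ l)) (cong₂ _*_ (square-^ x (2 ^ l)) (square-^ x (2 ^ l)))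

2-or-odd : ∀ {r} → Prime r → r ≡ 2 ⊎ r % 2 ≡ 1
2-or-odd {r} pr with half-cases r
... | h , inj₁ refl = inj₁ (sym (prime∣prime prime[2] pr (m∣m*n h)))
... | h , inj₂ refl = inj₂ (odd%2 h)

odd⇒1or3mod4 : ∀ n → n % 2 ≡ 1 → n % 4 ≡ 1 ⊎ n % 4 ≡ 3
odd⇒1or3mod4 n odd = cases (m%n<n n 4) (trans (m∣n⇒o%n%m≡o%m 2 4 n (divides 2 refl)) odd)
  where
  cases : ∀ {c} → c < 4 → c % 2 ≡ 1 → c ≡ 1 ⊎ c ≡ 3
  cases = toWitness {a? = allUpTo? (λ c → (c % 2 ≟ 1) →-dec ((c ≟ 1) ⊎-dec (c ≟ 3))) 4} tt

1mod4⇒1or5mod8 : ∀ n → n % 4 ≡ 1 → n % 8 ≡ 1 ⊎ n % 8 ≡ 5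
1mod4⇒1or5mod8 n eq = cases (m%n<n n 8) (trans (m∣n⇒o%n%m≡o%m 4 8 n (divides 2 refl)) eq)
  where
  cases : ∀ {c} → c < 8 → c % 4 ≡ 1 → c ≡ 1 ⊎ c ≡ 5
  cases = toWitness {a? = allUpTo? (λ c → (c % 4 ≟ 1) →-dec ((c ≟ 1) ⊎-dec (c ≟ 5))) 8} tt

∣y²+1⇒1mod4 : ∀ n → n % 2 ≡ 1 → ∀ y → n ∣ y * y + 1 → n % 4 ≡ 1
∣y²+1⇒1mod4 n odd y n∣ with odd⇒1or3mod4 n odd
... | inj₁ eq = eq
... | inj₂ eq = contradiction n∣ (3mod4∤y²+1 n eq y)

∣y⁴+1⇒1mod8 : ∀ n → n % 2 ≡ 1 → ∀ y → n ∣ y * y * (y * y) + 1 → n % 8 ≡ 1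
∣y⁴+1⇒1mod8 n odd y n∣ with 1mod4⇒1or5mod8 n (∣y²+1⇒1mod4 n odd (y * y) n∣)
... | inj₁ eq = eq
... | inj₂ eq = contradiction n∣ (5mod8∤y⁴+1 n eq y)

∣Σbits⇒1mod4 : ∀ {r} → Prime r → r % 2 ≡ 1 → ∀ x {a} (b : Bits a) → r ∣ Σbits (x * x) b → r % 4 ≡ 1
∣Σbits⇒1mod4 pr odd x b r∣ with prime∣Σbits-² pr x b r∣
... | y , d = ∣y²+1⇒1mod4 _ odd y d

∣Σbits⇒1mod8 : ∀ {r} → Prime r → r % 2 ≡ 1 → ∀ x {a} (b : Bits a) → r ∣ Σbits (x * x * (x * x)) b → r % 8 ≡ 1
∣Σbits⇒1mod8 pr odd x b r∣ with prime∣Σbits-⁴ pr x b r∣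
... | y , d = ∣y⁴+1⇒1mod8 _ odd y d

3∤Σbits : ∀ x {a} (b : Bits a) → ¬ 3 ∣ Σbits (x * x) b
3∤Σbits x b 3∣ = case ∣Σbits⇒1mod4 (toWitness {a? = prime? 3} tt) refl x b 3∣ of λ ()

-- Prime factors 3 mod 4, Mersenne numbers and Fermat numbers.

product-3mod4 : ∀ L → product L % 4 ≡ 3 → ∃[ q ] q ∈ L × q % 4 ≡ 3
product-3mod4 (q ∷ L) eq with q % 4 ≟ 3
... | yes q≡3 = q , here refl , q≡3
... | no q≢3 with product-3mod4 L (cases (m%n<n q 4) (m%n<n (product L) 4) (trans (sym (%-distribˡ-* q (product L) 4)) eq) q≢3)
  where
  cases : ∀ {c} → c < 4 → ∀ {d} → d < 4 → (c * d) % 4 ≡ 3 → c ≢ 3 → d ≡ 3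
  cases = toWitness {a? = allUpTo? (λ c → allUpTo? (λ d → ((c * d) % 4 ≟ 3) →-dec (¬? (c ≟ 3) →-dec (d ≟ 3))) 4) 4} tt
...   | q′ , q′∈ , q′≡3 = q′ , there q′∈ , q′≡3

3mod4-prime-factor : ∀ n → n % 4 ≡ 3 → ∃[ r ] Prime r × r ∣ n × r % 4 ≡ 3
3mod4-prime-factor n@(suc _) eq with factorise n
... | record { factors = rs ; isFactorisation = n≡ ; factorsPrime = prs } with product-3mod4 rs (subst (λ n → n % 4 ≡ 3) n≡ eq)
...   | r , r∈ , r≡3 = r , All.lookup prs r∈ , subst (r ∣_) (sym n≡) (∈⇒∣product r∈) , r≡3

-- 2 ^ n is congruent to some 2 ^ j with j < a modulo 2 ^ a ∸ 1.
mersenne∤2^+1 : ∀ d a → 3 ≤ a → suc d ≡ 2 ^ a → ∀ n → ¬ d ∣ 2 ^ n + 1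
mersenne∤2^+1 d a 3≤a 1+d≡2^a = <-rec (λ n → ¬ d ∣ 2 ^ n + 1) step
  where
  step : ∀ n → (∀ {k} → k < n → ¬ d ∣ 2 ^ k + 1) → ¬ d ∣ 2 ^ n + 1
  step n rec d∣ with a ≤? n
  ... | yes a≤n = rec {n ∸ a} (∸-monoʳ-< (≤-trans (s≤s z≤n) 3≤a) a≤n) (∣m+n∣m⇒∣n (subst (d ∣_) eq d∣) (m∣m*n (2 ^ (n ∸ a))))
    where
    open ≡-Reasoning
    eq : 2 ^ n + 1 ≡ d * 2 ^ (n ∸ a) + (2 ^ (n ∸ a) + 1)
    eq = begin
      2 ^ n + 1                                   ≡⟨ cong (λ k → 2 ^ k + 1) (m+[n∸m]≡n a≤n) ⟨
      2 ^ (a + (n ∸ a)) + 1                       ≡⟨ cong (_+ 1) (^-distribˡ-+-* 2 a (n ∸ a)) ⟩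
      2 ^ a * 2 ^ (n ∸ a) + 1                     ≡⟨ cong (λ k → k * 2 ^ (n ∸ a) + 1) 1+d≡2^a ⟨
      suc d * 2 ^ (n ∸ a) + 1                     ≡⟨ lemma d (2 ^ (n ∸ a)) ⟩
      d * 2 ^ (n ∸ a) + (2 ^ (n ∸ a) + 1)         ∎
      where
      lemma : ∀ d x → suc d * x + 1 ≡ d * x + (x + 1)
      lemma = solve-∀
  ... | no a≰n = <⇒≱ (s≤s⁻¹ (begin-strict
      suc (2 ^ n + 1)        ≡⟨ lemma (2 ^ n) ⟩
      2 + 2 ^ n              ≤⟨ +-monoʳ-≤ 2 (^-monoʳ-≤ 2 n≤) ⟩
      2 + 2 ^ pred a         <⟨ +-monoˡ-< (2 ^ pred a) (<-≤-trans (s≤s (s≤s (s≤s z≤n))) (^-monoʳ-≤ 2 (pred-mono-≤ 3≤a))) ⟩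
      2 ^ pred a + 2 ^ pred a ≡⟨ cong (2 ^ pred a +_) (+-identityʳ _) ⟨
      2 ^ suc (pred a)       ≡⟨ cong (2 ^_) (suc-pred a {{>-nonZero (≤-trans (s≤s z≤n) 3≤a)}}) ⟩
      2 ^ a                  ≡⟨ 1+d≡2^a ⟨
      suc d                  ∎)) (∣⇒≤ {{>-nonZero (m≤n+m 1 (2 ^ n))}} d∣)
    where
    open ≤-Reasoning
    n≤ : n ≤ pred a
    n≤ = pred-mono-≤ (≰⇒> a≰n)
    lemma : ∀ x → suc (x + 1) ≡ 2 + x
    lemma = solve-∀

odd-divisor-2^ : ∀ {d} n → ¬ 2 ∣ d → d ∣ 2 ^ n → d ≡ 1
odd-divisor-2^ {d} n odd d∣ = ∣1⇒≡1 (∤∣^* prime[2] n odd (subst (d ∣_) (sym (*-identityʳ (2 ^ n))) d∣))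

2∤odd : ∀ h → ¬ 2 ∣ 1 + 2 * h
2∤odd h 2∣ = case ∣1⇒≡1 (∣m+n∣m⇒∣n (subst (2 ∣_) (+-comm 1 (2 * h)) 2∣) (m∣m*n h)) of λ ()

-- ((1 + 2v) ^ c - 1) / 2v has the parity of c.
geometric : ∀ v c → ∃[ S ] (1 + 2 * v) ^ c ≡ 1 + 2 * v * S × S % 2 ≡ c % 2
geometric v zero = 0 , cong suc (sym (*-zeroʳ (2 * v))) , refl
geometric v (suc c) with geometric v c
... | S , eq , par = (1 + 2 * v * S) + S , trans (cong ((1 + 2 * v) *_) eq) (lemma (2 * v) S) ,
  trans (cong (_% 2) (lemma′ v S)) (trans ([m+kn]%n≡m%n (1 + S) (v * S) 2) (add-mod 2 1 S refl par ∙ sym (%-distribˡ-+ 1 c 2)))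
  where
  infixr 5 _∙_
  _∙_ = trans
  lemma : ∀ u S → (1 + u) * (1 + u * S) ≡ 1 + u * ((1 + u * S) + S)
  lemma = solve-∀
  lemma′ : ∀ v S → (1 + 2 * v * S) + S ≡ 1 + S + v * S * 2
  lemma′ = solve-∀

power-of-4 : ∀ i → ∃[ n ] 2 ^ (2 ^ suc i) ≡ 4 * 4 ^ n
power-of-4 i = pred (2 ^ i) , trans (^-double 2 (2 ^ i)) (cong (4 ^_) (sym (suc-pred (2 ^ i) {{m^n≢0 2 i}})))

4^%3 : ∀ n → 4 ^ n % 3 ≡ 1
4^%3 zero = refl
4^%3 (suc n) = mul-mod 3 4 (4 ^ n) refl (4^%3 n)

-- 3 is not a square modulo 4, and for `i ≥ 1` the Fermat number is 2 modulo 3.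
fermat≢square : ∀ i x → ¬ 1 + 2 ^ (2 ^ i) ≡ x * x
fermat≢square zero x eq = contradiction (trans (sym (%-distribˡ-* x x 4)) (cong (_% 4) (sym eq))) (cases (m%n<n x 4))
  where
  cases : ∀ {c} → c < 4 → (c * c) % 4 ≢ 3
  cases = toWitness {a? = allUpTo? (λ c → ¬? ((c * c) % 4 ≟ 3)) 4} tt
fermat≢square (suc i) x eq with power-of-4 i
... | n , eq′ = contradiction (trans (sym (%-distribˡ-* x x 3)) (trans (cong (_% 3) (trans (sym eq) (cong suc eq′)))
    (add-mod 3 1 (4 ^ suc n) refl (4^%3 (suc n))))) (cases (m%n<n x 3))
  where
  cases : ∀ {c} → c < 3 → (c * c) % 3 ≢ 2
  cases = toWitness {a? = allUpTo? (λ c → ¬? ((c * c) % 3 ≟ 2)) 3} tt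

-- An even `c` would give a square. For odd `c` the quotient (p ^ c - 1) / (p - 1) is odd and
-- divides a power of 2, so it is 1.
fermat-prime-power : ∀ i {p} → p % 2 ≡ 1 → ∀ c → 1 + 2 ^ (2 ^ i) ≡ p ^ c → p ≡ 1 + 2 ^ (2 ^ i)
fermat-prime-power i {p} odd c eq with half-cases c
... | h , inj₁ refl = contradiction (trans eq (^-double-* p h)) (fermat≢square i (p ^ h))
... | h , inj₂ refl with odd-view p odd
...   | v , refl with geometric v (1 + 2 * h)
...     | S , eq′ , par = trans (cong suc (trans (sym (*-identityʳ (2 * v))) (cong (2 * v *_) (sym S≡1)))) (trans (sym eq′) (sym eq))
  where
  2v*S : 2 * v * S ≡ 2 ^ (2 ^ i)
  2v*S = suc-injective (trans (sym eq′) (sym eq))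
  S≡1 : S ≡ 1
  S≡1 = odd-divisor-2^ (2 ^ i) 2∤S (divides (2 * v) (sym 2v*S))
    where
    2∤S : ¬ 2 ∣ S
    2∤S 2∣S = case trans (sym (n∣m⇒m%n≡0 S 2 2∣S)) (trans par (odd%2 h)) of λ ()

-- Divisors of `2 ^ e * p ^ f` and upper bounds for products.

∣^*⇒ : ∀ {r} → Prime r → ∀ {d} a {m} → .{{NonZero d}} → d ∣ r ^ a * m → ∃[ b ] ∃[ d′ ] d ≡ r ^ b * d′ × d′ ∣ m × ¬ r ∣ d′
∣^*⇒ {r} pr {d} a d∣ with split-power pr d
... | b , d′ , refl , r∤d′ = b , d′ , refl , ∤∣^* pr a r∤d′ (∣-trans (n∣m*n (r ^ b)) d∣) , r∤d′

divisor-2^p^ : ∀ {p d} → Prime p → ∀ e f → .{{NonZero d}} → d ∣ 2 ^ e * p ^ f → ∃[ a ] ∃[ b ] d ≡ 2 ^ a * p ^ b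
divisor-2^p^ {p} pp e f d∣ with ∣^*⇒ prime[2] e d∣
... | a , d′ , refl , d′∣ , 2∤d′ with ∣^*⇒ pp f {1} {{∤⇒NonZero 2∤d′}} (subst (d′ ∣_) (sym (*-identityʳ (p ^ f))) d′∣)
...   | b , d″ , refl , d″∣1 , _ = a , b , cong (λ k → 2 ^ a * k) (trans (cong (p ^ b *_) (∣1⇒≡1 d″∣1)) (*-identityʳ (p ^ b)))

-- σ∞ (x ^ a) / x ^ a < x / (x - 1), as a partial product of ∏ (1 + x ^ - 2 ^ k).
Σbits-bound : ∀ u {a} (b : Bits a) → u * Σbits (suc u) b < suc u * suc u ^ a
Σbits-bound u zero = *-monoˡ-< 1 (n<1+n u)
Σbits-bound u (dbl {a} b) = *-cancelˡ-< (2 + u) (u * T′) (suc u * suc u ^ (2 * a)) (begin-strict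
  (2 + u) * (u * T′)                   ≡⟨ lemma u T′ ⟩
  (u + u * suc u) * T′                 <⟨ Σbits-bound (u + u * suc u) b ⟩
  x * x * (x * x) ^ a                  ≡⟨ cong (x * x *_) (^-double x a) ⟨
  x * x * x ^ (2 * a)                  ≤⟨ *-monoˡ-≤ (x ^ (2 * a)) (*-monoˡ-≤ x (n≤1+n x)) ⟩
  (2 + u) * x * x ^ (2 * a)            ≡⟨ *-assoc (2 + u) x _ ⟩
  (2 + u) * (x * x ^ (2 * a))          ∎)
  where
  open ≤-Reasoning
  x T′ : ℕ
  x = suc u
  T′ = Σbits (x * x) b
  lemma : ∀ u t → (2 + u) * (u * t) ≡ (u + u * suc u) * t
  lemma = solve-∀
Σbits-bound u (dbl1 {a} b) = begin-strict
  u * ((2 + u) * T′)                   ≡⟨ lemma u T′ ⟩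
  (u + u * suc u) * T′                 <⟨ Σbits-bound (u + u * suc u) b ⟩
  x * x * (x * x) ^ a                  ≡⟨ cong (x * x *_) (^-double x a) ⟨
  x * x * x ^ (2 * a)                  ≡⟨ *-assoc x x _ ⟩
  x * (x * x ^ (2 * a))                ∎
  where
  open ≤-Reasoning
  x T′ : ℕ
  x = suc u
  T′ = Σbits (x * x) b
  lemma : ∀ u t → u * ((2 + u) * t) ≡ (u + u * suc u) * t
  lemma = solve-∀

extract : ∀ {q : ℕ} {L} → q ∈ L → Unique L → ∃[ L′ ] L ↭ q ∷ L′ × Unique (q ∷ L′)
extract {q} q∈ u with ∈-∃++ q∈
... | xs , ys , refl = xs ++ ys , shift q xs ys , Unique-resp-↭ (↭⇒↭ₛ (shift q xs ys)) u

-- With Y = 2 + k the conclusion is ∏ (1 - 1/(1 + q)) ≥ 1 - 3/(2Y): the numbers 1 + q are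
-- terms of a geometric progression with ratio p ≥ 3 and first term at least Y, and ∑ 3 ^ - i = 3/2.
geometric-product-bound : ∀ p → 3 ≤ p → ∀ n s k L → Unique L → 2 + k ≤ 2 * p ^ s →
  (∀ {q} → q ∈ L → ∃[ b ] s ≤ b × b < s + n × suc q ≡ 2 * p ^ b) →
  (1 + 2 * k) * product (map suc L) ≤ (4 + 2 * k) * product L
geometric-product-bound p 3≤p zero s k [] u Y≤ h = *-monoˡ-≤ 1 (+-monoˡ-≤ (2 * k) (s≤s (z≤n {3})))
geometric-product-bound p 3≤p zero s k (q ∷ L) u Y≤ h with h (here refl)
... | b , s≤b , b<s , _ = contradiction s≤b (<⇒≱ (subst (b <_) (+-identityʳ s) b<s))
-- At most one member of `L` has exponent exactly `s`, namely `2 p ^ s - 1`; `n` counts the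
-- exponents still to be inspected.
geometric-product-bound p 3≤p (suc n) s k L u Y≤ h with pred (2 * p ^ s) ∈? L
... | no q∉ = geometric-product-bound p 3≤p n (suc s) k L u (≤-trans Y≤ (*-monoʳ-≤ 2 (m≤n*m (p ^ s) p {{>-nonZero (≤-trans (s≤s z≤n) 3≤p)}}))) h′
  where
  h′ : ∀ {q} → q ∈ L → ∃[ b ] suc s ≤ b × b < suc s + n × suc q ≡ 2 * p ^ b
  h′ q∈ with h q∈
  ... | b , s≤b , b< , eq = b , ≤∧≢⇒< s≤b (λ { refl → q∉ (subst (_∈ L) (cong pred eq) q∈) }) , subst (b <_) (+-suc s n) b< , eq
... | yes q∈ with extract q∈ u
...   | L′ , L↭ , (q∉ ∷ u′) = goal
  where
  q A B : ℕ
  q = pred (2 * p ^ s)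
  A = product (map suc L′)
  B = product L′
  1+q : suc q ≡ 2 * p ^ s
  1+q = suc-pred (2 * p ^ s) {{>-nonZero (≤-trans (s≤s z≤n) Y≤)}}
  h′ : ∀ {q′} → q′ ∈ L′ → ∃[ b ] suc s ≤ b × b < suc s + n × suc q′ ≡ 2 * p ^ b
  h′ q′∈ with h (∈-resp-↭ (↭-sym L↭) (there q′∈))
  ... | b , s≤b , b< , eq = b , ≤∧≢⇒< s≤b (λ { refl → All.lookup q∉ q′∈ (suc-injective (trans 1+q (sym eq))) }) , subst (b <_) (+-suc s n) b< , eq
  -- `4 + 3 * k` in place of `k` encodes 3Y, the lower bound that the remaining numbers `1 + q`
  -- satisfy.
  Y′≤ : 2 + (4 + 3 * k) ≤ 2 * p ^ suc s
  Y′≤ = begin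
    2 + (4 + 3 * k)  ≡⟨ lemma k ⟩
    3 * (2 + k)      ≤⟨ *-mono-≤ 3≤p Y≤ ⟩
    p * (2 * p ^ s)  ≡⟨ lemma′ p (p ^ s) ⟩
    2 * (p * p ^ s)  ∎
    where
    open ≤-Reasoning
    lemma : ∀ k → 2 + (4 + 3 * k) ≡ 3 * (2 + k)
    lemma = solve-∀
    lemma′ : ∀ p x → p * (2 * x) ≡ 2 * (p * x)
    lemma′ = solve-∀
  ih : (1 + 2 * (4 + 3 * k)) * A ≤ (4 + 2 * (4 + 3 * k)) * B
  ih = geometric-product-bound p 3≤p n (suc s) (4 + 3 * k) L′ u′ Y′≤ h′
  ih′ : (3 + 2 * k) * A ≤ (4 + 2 * k) * B
  ih′ = *-cancelˡ-≤ 3 (begin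
    3 * ((3 + 2 * k) * A)        ≡⟨ l₁ k A ⟩
    (1 + 2 * (4 + 3 * k)) * A    ≤⟨ ih ⟩
    (4 + 2 * (4 + 3 * k)) * B    ≡⟨ l₂ k B ⟩
    3 * ((4 + 2 * k) * B)        ∎)
    where
    open ≤-Reasoning
    l₁ : ∀ k A → 3 * ((3 + 2 * k) * A) ≡ (1 + 2 * (4 + 3 * k)) * A
    l₁ = solve-∀
    l₂ : ∀ k A → (4 + 2 * (4 + 3 * k)) * A ≡ 3 * ((4 + 2 * k) * A)
    l₂ = solve-∀
  -- The bound closes because (1 - 1/Y)(1 - 1/(2Y)) ≥ 1 - 3/(2Y): the first factor bounds the
  -- contribution of `q`, the second is `ih′` for the rest.
  mid : (1 + 2 * k) * A ≤ (2 + 2 * k) * B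
  mid = *-cancelˡ-≤ (2 + k) (begin
    (2 + k) * ((1 + 2 * k) * A)          ≤⟨ m≤m+n _ A ⟩
    (2 + k) * ((1 + 2 * k) * A) + A      ≡⟨ l₁ k A ⟩
    (1 + k) * ((3 + 2 * k) * A)          ≤⟨ *-monoʳ-≤ (1 + k) ih′ ⟩
    (1 + k) * ((4 + 2 * k) * B)          ≡⟨ l₂ k B ⟩
    (2 + k) * ((2 + 2 * k) * B)          ∎)
    where
    open ≤-Reasoning
    l₁ : ∀ k A → (2 + k) * ((1 + 2 * k) * A) + A ≡ (1 + k) * ((3 + 2 * k) * A)
    l₁ = solve-∀
    l₂ : ∀ k A → (1 + k) * ((4 + 2 * k) * A) ≡ (2 + k) * ((2 + 2 * k) * A)
    l₂ = solve-∀
  1+k≤q : 1 + k ≤ q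
  1+k≤q = s≤s⁻¹ (subst (2 + k ≤_) (sym 1+q) Y≤)
  open ≤-Reasoning
  goal : (1 + 2 * k) * product (map suc L) ≤ (4 + 2 * k) * product L
  goal = begin
    (1 + 2 * k) * product (map suc L)          ≡⟨ cong ((1 + 2 * k) *_) (product-↭ (Perm.map⁺ suc L↭)) ⟩
    (1 + 2 * k) * (suc q * A)                  ≡⟨ l₁ k q A ⟩
    suc q * ((1 + 2 * k) * A)                  ≤⟨ *-monoʳ-≤ (suc q) mid ⟩
    suc q * ((2 + 2 * k) * B)                  ≡⟨ l₂ k q B ⟩
    2 * B * ((1 + k) + (1 + k) * q)            ≤⟨ *-monoʳ-≤ (2 * B) (+-monoˡ-≤ ((1 + k) * q) 1+k≤q) ⟩
    2 * B * (q + (1 + k) * q)                  ≡⟨ l₃ k q B ⟩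
    (4 + 2 * k) * (q * B)                      ≡⟨ cong ((4 + 2 * k) *_) (product-↭ L↭) ⟨
    (4 + 2 * k) * product L                    ∎
    where
    l₁ : ∀ k q A → (1 + 2 * k) * (suc q * A) ≡ suc q * ((1 + 2 * k) * A)
    l₁ = solve-∀
    l₂ : ∀ k q B → suc q * ((2 + 2 * k) * B) ≡ 2 * B * ((1 + k) + (1 + k) * q)
    l₂ = solve-∀
    l₃ : ∀ k q B → 2 * B * (q + (1 + k) * q) ≡ (4 + 2 * k) * (q * B)
    l₃ = solve-∀

-- The density argument and splitting off the lowest digit.

abstract
  prime[3] : Prime 3
  prime[3] = toWitness {a? = prime? 3} tt

  prime[5] : Prime 5
  prime[5] = toWitness {a? = prime? 5} tt

pow-mod1 : ∀ n → .{{_ : NonZero n}} → ∀ x → x % n ≡ 1 % n → ∀ k → x ^ k % n ≡ 1 % n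
pow-mod1 n x x≡1 zero = refl
pow-mod1 n x x≡1 (suc k) = trans (mul-mod n x (x ^ k) x≡1 (pow-mod1 n x x≡1 k))
  (trans (sym (%-distribˡ-* 1 1 n)) refl)

product≤product-suc : ∀ L → product L ≤ product (map suc L)
product≤product-suc [] = ≤-refl
product≤product-suc (q ∷ L) = *-mono-≤ (n≤1+n q) (product≤product-suc L)

product<product-suc : ∀ L → 1 < product L → product L < product (map suc L)
product<product-suc [] 1<1 = contradiction 1<1 (<-irrefl refl)
product<product-suc (q ∷ L) 1<qL = begin-strict
  q * product L                          <⟨ m<n+m (q * product L) (n≢0⇒n>0 λ L≡0 → >⇒≢ (<-trans (s≤s z≤n) 1<qL) (trans (cong (q *_) L≡0) (*-zeroʳ q))) ⟩
  product L + q * product L              ≤⟨ *-monoʳ-≤ (suc q) (product≤product-suc L) ⟩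
  suc q * product (map suc L)            ∎
  where open ≤-Reasoning

Σbits-> : ∀ x {a} (b : Bits a) y {c} (d : Bits c) → 1 < x ^ a * y ^ c → x ^ a * y ^ c < Σbits x b * Σbits y d
Σbits-> x {a} b y {c} d 1< = subst₂ _<_ pr≡ σ≡ (product<product-suc (comps x b ++ comps y d) (subst (1 <_) (sym pr≡) 1<))
  where
  pr≡ : product (comps x b ++ comps y d) ≡ x ^ a * y ^ c
  pr≡ = trans (product-++ (comps x b) (comps y d)) (cong₂ _*_ (product-comps x b) (product-comps y d))
  σ≡ : product (map suc (comps x b ++ comps y d)) ≡ Σbits x b * Σbits y d
  σ≡ = trans (cong product (map-++ suc (comps x b) _)) (product-++ (map suc (comps x b)) _)

-- Splitting off known components from N and M leaves the products of L and x ^ a * y ^ c; the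
-- components split off contribute at least 2 to (σ∞ N / N)(σ∞ M / M), which equals 2.
density : ∀ α β γ δ L x {a} (b : Bits a) y {c} (d : Bits c) → 1 ≤ β * δ → α * δ ≤ β * γ → 1 < x ^ a * y ^ c →
  α * product L ≡ β * (Σbits x b * Σbits y d) → γ * product (map suc L) ≡ δ * (x ^ a * y ^ c) → ⊥
density α β γ δ L x {a} b y {c} d 1≤βδ αδ≤βγ 1<X αY γY′ = <-irrefl refl (begin-strict
  α * δ * Y        ≤⟨ *-mono-≤ αδ≤βγ (product≤product-suc L) ⟩
  β * γ * Y′       ≡⟨ *-assoc β γ Y′ ⟩
  β * (γ * Y′)     ≡⟨ cong (β *_) γY′ ⟩
  β * (δ * X)      ≡⟨ *-assoc β δ X ⟨
  β * δ * X        <⟨ *-monoʳ-< (β * δ) {{>-nonZero 1≤βδ}} (Σbits-> x b y d 1<X) ⟩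
  β * δ * T′       ≡⟨ l₂ β δ T′ ⟩
  δ * (β * T′)     ≡⟨ cong (δ *_) αY ⟨
  δ * (α * Y)      ≡⟨ l₁ α δ Y ⟩
  α * δ * Y        ∎)
  where
  open ≤-Reasoning
  Y Y′ X T′ : ℕ
  Y = product L
  Y′ = product (map suc L)
  X = x ^ a * y ^ c
  T′ = Σbits x b * Σbits y d
  l₁ : ∀ α δ Y → δ * (α * Y) ≡ α * δ * Y
  l₁ = solve-∀
  l₂ : ∀ β δ T → β * δ * T ≡ δ * (β * T)
  l₂ = solve-∀

-- Here `δ < γ` replaces the assumption that the rest of M exceeds 1: since the product of the
-- `1 + q` is at least 1, the last equation makes that rest at least γ/δ.
density′ : ∀ α β γ δ L x {a} (b : Bits a) y {c} (d : Bits c) → 1 ≤ β * δ → α * δ ≤ β * γ → δ < γ →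
  α * product L ≡ β * (Σbits x b * Σbits y d) → γ * product (map suc L) ≡ δ * (x ^ a * y ^ c) → ⊥
density′ α β γ δ L x {a} b y {c} d 1≤βδ αδ≤βγ δ<γ αY γY′ = density α β γ δ L x b y d 1≤βδ αδ≤βγ 1<X αY γY′
  where
  open ≤-Reasoning
  product-suc>0 : ∀ L → 0 < product (map suc L)
  product-suc>0 [] = s≤s z≤n
  product-suc>0 (q ∷ L) = *-mono-≤ (s≤s (z≤n {q})) (product-suc>0 L)
  1<X : 1 < x ^ a * y ^ c
  1<X = *-cancelˡ-< δ 1 _ (begin-strict
    δ * 1                     ≡⟨ *-identityʳ δ ⟩
    δ                         <⟨ δ<γ ⟩
    γ                         ≡⟨ *-identityʳ γ ⟨
    γ * 1                     ≤⟨ *-monoʳ-≤ γ (product-suc>0 L) ⟩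
    γ * product (map suc L)   ≡⟨ γY′ ⟩
    δ * (x ^ a * y ^ c)       ∎)

-- The alternative is whether `x` itself occurs among the components of `x ^ a`; the remaining
-- digits are read in base `x * x`.
data Halved (x : ℕ) {a} (b : Bits a) : Set where
  even : ∀ {h} (b′ : Bits h) → a ≡ 2 * h → x ^ a ≡ (x * x) ^ h → Σbits x b ≡ Σbits (x * x) b′ → Halved x b
  odd  : ∀ {h} (b′ : Bits h) → a ≡ 1 + 2 * h → x ^ a ≡ x * (x * x) ^ h → Σbits x b ≡ suc x * Σbits (x * x) b′ → Halved x b

halve : ∀ x {a} (b : Bits a) → Halved x b
halve x zero = even zero refl refl refl
halve x (dbl {a} b) = even b refl (^-double x a) refl
halve x (dbl1 {a} b) = odd b refl (cong (x *_) (^-double x a)) refl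

euclidʳ : ∀ {r} → Prime r → ∀ m n → ¬ r ∣ m → r ∣ m * n → r ∣ n
euclidʳ pr m n r∤m r∣ with euclidsLemma m n pr r∣
... | inj₁ r∣m = contradiction r∣m r∤m
... | inj₂ r∣n = r∣n

prime∤⇒∤* : ∀ {r} → Prime r → ∀ m n → ¬ r ∣ m → ¬ r ∣ n → ¬ r ∣ m * n
prime∤⇒∤* pr m n r∤m r∤n r∣ with euclidsLemma m n pr r∣
... | inj₁ r∣m = r∤m r∣m
... | inj₂ r∣n = r∤n r∣n

odd⇒2∤ : ∀ n → n % 2 ≡ 1 → ¬ 2 ∣ n
odd⇒2∤ n n%2 2∣n = case trans (sym n%2) (n∣m⇒m%n≡0 n 2 2∣n) of λ ()

IsComp>1 : ∀ {q} → IsComp q → 1 < q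
IsComp>1 (r , l , pr , refl) = ≤-trans (s≤s (m^n>0 2 l)) (n<m^n (prime>1 pr) (2 ^ l))

prime-part-of : ∀ {r} → Prime r → ∀ L → (∀ {q} → q ∈ L → IsComp q) → r ∣ product L → ∃[ l ] r ^ (2 ^ l) ∈ L
prime-part-of pr L isComp r∣ with prime∣product pr L r∣
... | q , q∈ , r∣q with isComp q∈
...   | s , l , ps , refl with prime∣prime pr ps (prime∣^ pr s (2 ^ l) r∣q)
...     | refl = l , q∈

-- Components of N when M = 2 ^ e p ^ f.

module Parts {p} (pp : Prime p) (p-odd : p % 2 ≡ 1) {L}
  (isComp : ∀ {q} → q ∈ L → IsComp q) {e f} (M≡ : product (map suc L) ≡ 2 ^ e * p ^ f) where

  instance
    N≢0 : NonZero (product L)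
    N≢0 = product≢0 (All.tabulate λ q∈ → >-nonZero (<-trans (s≤s z≤n) (IsComp>1 (isComp q∈))))

  prime-part : ∀ {r} → Prime r → r ∣ product L → ∃[ l ] r ^ (2 ^ l) ∈ L
  prime-part pr = prime-part-of pr L isComp

  suc-part : ∀ {q} → q ∈ L → ∃[ a ] ∃[ b ] suc q ≡ 2 ^ a * p ^ b
  suc-part {q} q∈ = divisor-2^p^ pp e f (subst (suc q ∣_) M≡ (∈⇒∣product (∈-map⁺ suc q∈)))

  2∤p : ¬ 2 ∣ p
  2∤p = odd⇒2∤ p p-odd

  2∤p^ : ∀ b → ¬ 2 ∣ p ^ b
  2∤p^ b 2∣ = 2∤p (prime∣^ prime[2] p b 2∣)

  suc-part-1mod4 : ∀ {q} → q ∈ L → q % 4 ≡ 1 → ∃[ b ] suc q ≡ 2 * p ^ suc b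
  suc-part-1mod4 {q} q∈ q%4 = go (suc-part q∈)
    where
    1+q%4 : suc q % 4 ≡ 2
    1+q%4 = add-mod 4 1 q refl q%4
    go : ∃[ a ] ∃[ b ] suc q ≡ 2 ^ a * p ^ b → ∃[ b ] suc q ≡ 2 * p ^ suc b
    go (zero , b , eq) = contradiction (subst (2 ∣_) (trans eq (*-identityˡ (p ^ b)))
      (m%n≡0⇒n∣m (suc q) 2 (%-% 2 4 (divides 2 refl) (suc q) 1+q%4))) (2∤p^ b)
    go (1 , zero , eq) = contradiction (suc-injective eq) (>⇒≢ (IsComp>1 (isComp q∈)))
    go (1 , suc b , eq) = b , eq
    go (2+ a , b , eq) = case trans (sym 1+q%4) (n∣m⇒m%n≡0 (suc q) 4 (subst (4 ∣_) (sym eq)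
      (∣m⇒∣m*n (p ^ b) (divides (2 ^ a) (lemma (2 ^ a)))))) of λ ()
      where
      lemma : ∀ x → 2 * (2 * x) ≡ x * 4
      lemma = solve-∀

Σbits≥ : ∀ x {a} (b : Bits a) → x ^ a ≤ Σbits x b
Σbits≥ x b = subst (_≤ Σbits x b) (product-comps x b) (product≤product-suc (comps x b))

odd*odd : ∀ {x} → x % 2 ≡ 1 → (x * x) % 2 ≡ 1
odd*odd {x} x-odd = mul-mod 2 x x x-odd x-odd

2∣suc-odd : ∀ {x} → x % 2 ≡ 1 → 2 ∣ suc x
2∣suc-odd {x} x-odd = m%n≡0⇒n∣m (suc x) 2 (add-mod 2 1 x refl x-odd)

-- Each digit 1 contributes `1 + x ^ 2 ^ l`, which is even for odd `x`.
Σbits-unit-or-even : ∀ {x} → x % 2 ≡ 1 → ∀ {a} (b : Bits a) → (Σbits x b ≡ 1 × x ^ a ≡ 1) ⊎ 2 ∣ Σbits x b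
Σbits-unit-or-even x-odd zero = inj₁ (refl , refl)
Σbits-unit-or-even {x} x-odd (dbl {a} b) with Σbits-unit-or-even (odd*odd {x} x-odd) b
... | inj₁ (σ≡1 , x^≡1) = inj₁ (σ≡1 , trans (^-double x a) x^≡1)
... | inj₂ 2∣σ = inj₂ 2∣σ
Σbits-unit-or-even {x} x-odd (dbl1 b) = inj₂ (∣m⇒∣m*n (Σbits (x * x) b) (2∣suc-odd {x} x-odd))

-- If x ≡ -1 modulo r then 1 + x ^ 2 ^ k ≡ 2 for k ≥ 1, so r divides at most one of the factors.
prime-power-Σbits : ∀ {r} → Prime r → r % 2 ≡ 1 → ∀ {x} → 1 < x → ∀ {a} (b : Bits a) → Σbits x b ≢ 1 →
  (∀ {s} → Prime s → s ∣ Σbits x b → s ≡ r) → ∃[ k ] Σbits x b ≡ suc (x ^ (2 ^ k))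
prime-power-Σbits pr r-odd 1<x zero σ≢1 only = contradiction refl σ≢1
prime-power-Σbits pr r-odd {x} 1<x (dbl b) σ≢1 only with prime-power-Σbits pr r-odd (<-trans 1<x (s<s*s 1<x)) b σ≢1 only
... | k , eq = suc k , trans eq (cong suc (sym (^-double x (2 ^ k))))
prime-power-Σbits {r} pr r-odd {x} 1<x (dbl1 {a} b) σ≢1 only with Σbits (x * x) b ≟ 1
... | yes σ≡1 = 0 , trans (cong (suc x *_) σ≡1) (trans (*-identityʳ (suc x)) (cong suc (sym (*-identityʳ x))))
... | no σ≢1′ with prime-power-Σbits pr r-odd (<-trans 1<x (s<s*s 1<x)) b σ≢1′ (λ ps s∣ → only ps (∣n⇒∣m*n (suc x) s∣))
...   | k , eq = ⊥-elim (odd⇒2∤ r r-odd (∣-reflexive (sym (prime∣prime pr prime[2] r∣2))))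
  where
  instance
    r≢0 : NonZero r
    r≢0 = prime⇒nonZero pr
  r∣suc-x : r ∣ suc x
  r∣suc-x with prime-divisor (suc x) (m<n⇒m<1+n 1<x)
  ... | s , ps , s∣ = subst (_∣ suc x) (only ps (∣m⇒∣m*n _ s∣)) s∣
  r∣σ : r ∣ suc ((x * x) ^ (2 ^ k))
  r∣σ with prime-divisor (Σbits (x * x) b) (≤∧≢⇒< (≤-trans (m^n>0 (x * x) {{x²≢0}} a) (Σbits≥ (x * x) b)) (σ≢1′ ∘ sym))
    where
    x²≢0 : NonZero (x * x)
    x²≢0 = >-nonZero (<-trans (s≤s z≤n) (<-trans 1<x (s<s*s 1<x)))
  ... | s , ps , s∣ = subst₂ _∣_ (only ps (∣n⇒∣m*n (suc x) s∣)) eq s∣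
  x²≡1 : (x * x) % r ≡ 1 % r
  x²≡1 = trans (cong (_% r) lemma) (%-remove-+ʳ 1 (∣n⇒∣m*n (pred x) r∣suc-x))
    where
    lemma : x * x ≡ 1 + pred x * suc x
    lemma = subst (λ x → x * x ≡ 1 + pred x * suc x) (suc-pred x {{>-nonZero (<-trans (s≤s z≤n) 1<x)}}) (go (pred x))
      where
      go : ∀ u → suc u * suc u ≡ 1 + u * (2 + u)
      go = solve-∀
  r∣2 : r ∣ 2
  r∣2 = m%n≡0⇒n∣m 2 r (trans (%-distribˡ-+ 1 1 r) (trans (sym (add-mod r 1 ((x * x) ^ (2 ^ k)) refl (pow-mod1 r (x * x) x²≡1 (2 ^ k))))
          (n∣m⇒m%n≡0 (suc ((x * x) ^ (2 ^ k))) r r∣σ)))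

-- Odd N.

module OddCase {p} (pp : Prime p) (p-odd : p % 2 ≡ 1) {L} (L-unique : Unique L)
  (isComp : ∀ {q} → q ∈ L → IsComp q) {e f} (M≡ : product (map suc L) ≡ 2 ^ e * p ^ f)
  (be : Bits e) (bf : Bits f) (N≡ : Σbits 2 be * Σbits p bf ≡ 2 * product L)
  (2∤N : ¬ 2 ∣ product L) (2∣M : 2 ∣ product (map suc L)) where

  open Parts pp p-odd isComp {e} {f} M≡

  N M : ℕ
  N = product L
  M = product (map suc L)

  3≤p : 3 ≤ p
  3≤p = ≤∧≢⇒< (prime>1 pp) λ { refl → 2∤p ∣-refl }

  odd-divisor : ∀ {r} → Prime r → r ∣ N → r % 2 ≡ 1
  odd-divisor pr r∣N with 2-or-odd pr
  ... | inj₁ refl = contradiction r∣N 2∤N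
  ... | inj₂ r-odd = r-odd

  4∤2N : ¬ 4 ∣ 2 * N
  4∤2N 4∣ = 2∤N (*-cancelˡ-∣ 2 4∣)

  module EvenF {k} (bk : Bits k) (p^f≡ : p ^ f ≡ (p * p) ^ k) (σf≡ : Σbits p bf ≡ Σbits (p * p) bk) where
    -- With bases 4 and p² ≥ 9, `Σbits-bound` gives 2N < (4/3)(9/8) M, and the components, all of
    -- the form 2p ^ b - 1 with b ≥ 1, give M ≤ (4/3) N. The three constants multiply to exactly 2,
    -- and the first estimate is strict.
    even-e : ∀ {h} (bh : Bits h) → 2 ^ e ≡ 4 ^ h → Σbits 2 be ≡ Σbits 4 bh → ⊥
    even-e {h} bh 2^e≡ σe≡ = <-irrefl refl (begin-strict
        48 * N                                          ≡⟨ l₁ N ⟩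
        24 * (2 * N)                                    ≡⟨ cong (24 *_) (trans (sym N≡) (cong₂ _*_ σe≡ σf≡)) ⟩
        24 * (σ₄ * σ₂)                                  ≡⟨ l₂ σ₄ σ₂ ⟩
        3 * σ₄ * (8 * σ₂)                               <⟨ *-mono-< (Σbits-bound 3 bh) (bound8 (pred (p * p)) 8≤u bound) ⟩
        4 * 4 ^ h * (9 * (p * p) ^ k)                   ≡⟨ l₃ (4 ^ h) ((p * p) ^ k) ⟩
        4 * (9 * (4 ^ h * (p * p) ^ k))                 ≡⟨ cong (λ m → 4 * (9 * m)) (trans (sym (cong₂ _*_ 2^e≡ p^f≡)) (sym M≡)) ⟩
        4 * (9 * M)                                     ≤⟨ *-monoʳ-≤ 4 9M≤12N ⟩
        4 * (12 * N)                                    ≡⟨ l₄ N ⟩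
        48 * N                                          ∎)
      where
      open ≤-Reasoning
      σ₄ σ₂ : ℕ
      σ₄ = Σbits 4 bh
      σ₂ = Σbits (p * p) bk
      l₁ : ∀ N → 48 * N ≡ 24 * (2 * N)
      l₁ = solve-∀
      l₂ : ∀ a b → 24 * (a * b) ≡ 3 * a * (8 * b)
      l₂ = solve-∀
      l₃ : ∀ a b → 4 * a * (9 * b) ≡ 4 * (9 * (a * b))
      l₃ = solve-∀
      l₄ : ∀ N → 4 * (12 * N) ≡ 48 * N
      l₄ = solve-∀
      1+u : suc (pred (p * p)) ≡ p * p
      1+u = suc-pred (p * p) {{>-nonZero (≤-trans (s≤s z≤n) (*-mono-≤ 3≤p 3≤p))}}
      8≤u : 8 ≤ pred (p * p)
      8≤u = s≤s⁻¹ (subst (9 ≤_) (sym 1+u) (*-mono-≤ 3≤p 3≤p))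
      bound : pred (p * p) * σ₂ < suc (pred (p * p)) * (p * p) ^ k
      bound = subst (λ x → pred (p * p) * Σbits x bk < suc (pred (p * p)) * x ^ k) 1+u (Σbits-bound (pred (p * p)) bk)
      bound8 : ∀ u {T X} → 8 ≤ u → u * T < suc u * X → 8 * T < 9 * X
      bound8 u {T} {X} 8≤u b = *-cancelˡ-< u (8 * T) (9 * X) (begin-strict
        u * (8 * T)            ≡⟨ m₁ u T ⟩
        8 * (u * T)            <⟨ *-monoʳ-< 8 b ⟩
        8 * (suc u * X)        ≡⟨ m₂ u X ⟩
        8 * X + u * (8 * X)    ≤⟨ +-monoˡ-≤ (u * (8 * X)) (*-monoˡ-≤ X 8≤u) ⟩
        u * X + u * (8 * X)    ≡⟨ m₃ u X ⟩
        u * (9 * X)            ∎)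
        where
        m₁ : ∀ u T → u * (8 * T) ≡ 8 * (u * T)
        m₁ = solve-∀
        m₂ : ∀ u X → 8 * (suc u * X) ≡ 8 * X + u * (8 * X)
        m₂ = solve-∀
        m₃ : ∀ u X → u * X + u * (8 * X) ≡ u * (9 * X)
        m₃ = solve-∀
      q%4 : ∀ {q} → q ∈ L → q % 4 ≡ 1
      q%4 q∈ with isComp q∈
      ... | r , l , pr , refl = pow-mod1 4 r r%4 (2 ^ l)
        where
        r∣N : r ∣ N
        r∣N = ∣-trans (n∣n^ r (2 ^ l) {{m^n≢0 2 l}}) (∈⇒∣product q∈)
        r%4 : r % 4 ≡ 1
        r%4 with euclidsLemma σ₄ σ₂ pr (subst (r ∣_) (trans (sym N≡) (cong₂ _*_ σe≡ σf≡)) (∣n⇒∣m*n 2 r∣N))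
        ... | inj₁ r∣ = ∣Σbits⇒1mod4 pr (odd-divisor pr r∣N) 2 bh r∣
        ... | inj₂ r∣ = ∣Σbits⇒1mod4 pr (odd-divisor pr r∣N) p bk r∣
      form : ∀ {q} → q ∈ L → ∃[ b ] 1 ≤ b × b < 1 + suc N × suc q ≡ 2 * p ^ b
      form {q} q∈ with suc-part-1mod4 q∈ (q%4 q∈)
      ... | b , eq = suc b , s≤s z≤n , s≤s (≤-trans (<⇒≤ (begin-strict
          suc b            <⟨ n<m^n (prime>1 pp) (suc b) ⟩
          p ^ suc b        ≤⟨ m≤n*m (p ^ suc b) 2 ⟩
          2 * p ^ suc b    ≡⟨ eq ⟨
          suc q            ∎)) (s≤s (∣⇒≤ (∈⇒∣product q∈)))) , eq
      9M≤12N : 9 * M ≤ 12 * N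
      -- `k = 4` means Y = 6, the least possible value of 2p, and yields the factor 1 - 3/12 = 9/12.
      9M≤12N = geometric-product-bound p 3≤p (suc N) 1 4 L L-unique
        (*-monoʳ-≤ 2 (subst (3 ≤_) (sym (*-identityʳ p)) 3≤p)) form

    -- The component 2 of M contributes 3 to 2N, so N has a component that is a power of 3. It is
    -- not divisible by 9, since the other factors of 2N are of the form `y² + 1`. And 3 in N
    -- together with 2 in M already contributes (4/3)(3/2) = 2.
    odd-e : ∀ {h} (bh : Bits h) → 2 ^ e ≡ 2 * 4 ^ h → Σbits 2 be ≡ 3 * Σbits 4 bh → ⊥
    odd-e {h} bh 2^e≡ σe≡ = go (prime-part prime[3] 3∣N)
      where
      2N≡ : 2 * N ≡ 3 * (Σbits 4 bh * Σbits (p * p) bk)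
      2N≡ = trans (sym N≡) (trans (cong₂ _*_ σe≡ σf≡) (*-assoc 3 (Σbits 4 bh) _))
      3∣N : 3 ∣ N
      3∣N with euclidsLemma 2 N prime[3] (subst (3 ∣_) (sym 2N≡) (m∣m*n (Σbits 4 bh * Σbits (p * p) bk)))
      ... | inj₂ d = d
      ... | inj₁ d = contradiction (∣⇒≤ d) λ { (s≤s (s≤s ())) }
      go : ∃[ l ] 3 ^ (2 ^ l) ∈ L → ⊥
      go (suc l , q∈) = prime∤⇒∤* prime[3] _ _ (3∤Σbits 2 bh) (3∤Σbits p bk)
        (*-cancelˡ-∣ 3 (subst (9 ∣_) 2N≡ (∣n⇒∣m*n 2 (∣-trans 9∣q (∈⇒∣product q∈)))))
        where
        9∣q : 9 ∣ 3 ^ (2 ^ suc l)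
        9∣q = subst (9 ∣_) (sym (^-double 3 (2 ^ l))) (n∣n^ 9 (2 ^ l) {{m^n≢0 2 l}})
      go (zero , q∈) with extract q∈ L-unique
      ... | L′ , L↭ , _ = density′ 6 3 4 2 L′ 4 bh (p * p) bk (s≤s z≤n) ≤-refl (s≤s (s≤s (s≤s z≤n)))
        (trans (*-assoc 2 3 (product L′)) (trans (cong (2 *_) (sym (product-↭ L↭))) 2N≡))
        (trans (sym (product-↭ (Perm.map⁺ suc L↭))) (trans M≡ (trans (cong₂ _*_ 2^e≡ p^f≡) (*-assoc 2 (4 ^ h) _))))

    absurd : ⊥
    absurd with halve 2 be
    ... | even bh _ 2^e≡ σe≡ = even-e bh 2^e≡ σe≡
    ... | odd bh _ 2^e≡ σe≡ = odd-e bh 2^e≡ σe≡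

  module OddF (M≡2^e*p : M ≡ 2 ^ e * p) (2N≡ : Σbits 2 be * suc p ≡ 2 * N) where
    p%4 : p % 4 ≡ 1
    p%4 with odd⇒1or3mod4 p p-odd
    ... | inj₁ eq = eq
    ... | inj₂ eq = contradiction (subst (4 ∣_) 2N≡ (∣n⇒∣m*n (Σbits 2 be) (m%n≡0⇒n∣m (suc p) 4 (add-mod 4 1 p refl eq)))) 4∤2N

    -- `c` is the contribution of the lowest digit of e, namely 1 or 3, and `U` that of the higher
    -- digits. The condition on `c` keeps it out of the comparison of `r`-parts in `U≡q`.
    module _ {h} (bh : Bits h) c (c∤ : ∀ {r} → Prime r → r % 4 ≡ 1 → ¬ r ∣ c)
             (σe≡ : Σbits 2 be ≡ c * Σbits 4 bh) (U≢1 : Σbits 4 bh ≢ 1) where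
      U : ℕ
      U = Σbits 4 bh
      U*≡2N : U * (c * suc p) ≡ 2 * N
      U*≡2N = trans (lemma U c (suc p)) (trans (cong (_* suc p) (sym σe≡)) 2N≡)
        where
        lemma : ∀ U c x → U * (c * x) ≡ c * U * x
        lemma = solve-∀
      instance
        U≢0 : NonZero U
        U≢0 = >-nonZero (≤-trans (m^n>0 4 h) (Σbits≥ 4 bh))
      2∤U : ¬ 2 ∣ U
      2∤U 2∣U with prime∣Σbits prime[2] 4 bh 2∣U
      ... | l , 2∣ = case ∣1⇒≡1 (∣m+n∣m⇒∣n (subst (2 ∣_) (+-comm 1 (4 ^ (2 ^ l))) 2∣)
              (∣-trans (divides 2 refl) (n∣n^ 4 (2 ^ l) {{m^n≢0 2 l}}))) of λ ()
      divisor : ∀ {s} → Prime s → s ∣ U → s % 2 ≡ 1 × s % 4 ≡ 1 × s ∣ N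
      divisor {s} ps s∣U with 2-or-odd ps
      ... | inj₁ refl = contradiction s∣U 2∤U
      ... | inj₂ s-odd with euclidsLemma 2 N ps (subst (s ∣_) U*≡2N (∣m⇒∣m*n _ s∣U))
      ...   | inj₂ s∣N = s-odd , ∣Σbits⇒1mod4 ps s-odd 2 bh s∣U , s∣N
      ...   | inj₁ s∣2 = contradiction (∣-reflexive (sym (prime∣prime ps prime[2] s∣2))) (odd⇒2∤ s s-odd)
      -- As p divides M only once, N has just one component that is 1 mod 4, `q = 2p - 1`. Every
      -- prime of `U` is 1 mod 4 and divides N, so `U` is a power of a single prime `r`, and in fact
      -- `U = q`. As a power of one odd prime, `U` has a single factor `1 + 4 ^ 2 ^ k`; then 3
      -- divides p, against p ≡ 1 mod 4.
      U-absurd : ⊥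
      U-absurd with prime-divisor U (≤∧≢⇒< (>-nonZero⁻¹ U) (U≢1 ∘ sym))
      ... | r , pr , r∣U with divisor pr r∣U
      ...   | r-odd , r%4 , r∣N with prime-part pr r∣N
      ...     | l , q∈ with suc-part-1mod4 q∈ (pow-mod1 4 r r%4 (2 ^ l)) | extract q∈ L-unique
      ...       | b , 1+q≡ | L′ , L↭ , _ = final
        where
        q : ℕ
        q = r ^ (2 ^ l)
        M≡′ : suc q * product (map suc L′) ≡ 2 ^ e * p
        M≡′ = trans (sym (product-↭ (Perm.map⁺ suc L↭))) M≡2^e*p
        N≡′ : N ≡ q * product L′
        N≡′ = product-↭ L↭
        instance
          p≢0 : NonZero p
          p≢0 = prime⇒nonZero pp
        2p^bY′≡2^e : 2 * p ^ b * product (map suc L′) ≡ 2 ^ e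
        2p^bY′≡2^e = *-cancelˡ-≡ _ _ p (trans (lemma p (p ^ b) (product (map suc L′)))
          (trans (cong (_* product (map suc L′)) (sym 1+q≡)) (trans M≡′ (*-comm (2 ^ e) p))))
          where
          lemma : ∀ p x y → p * (2 * x * y) ≡ 2 * (p * x) * y
          lemma = solve-∀
        p∤2^e : ¬ p ∣ 2 ^ e
        p∤2^e p∣ = 2∤p (∣-reflexive (sym (prime∣prime pp prime[2] (prime∣^ pp 2 e p∣))))
        exponent≡0 : ∀ b → 2 * p ^ b * product (map suc L′) ≡ 2 ^ e → b ≡ 0
        exponent≡0 zero _ = refl
        exponent≡0 (suc b) eq = contradiction (subst (p ∣_) eq (∣m⇒∣m*n _ (∣n⇒∣m*n 2 (m∣m*n (p ^ b))))) p∤2^e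
        b≡0 : b ≡ 0
        b≡0 = exponent≡0 b 2p^bY′≡2^e
        1+q≡2p : suc q ≡ 2 * p
        1+q≡2p = trans 1+q≡ (cong (2 *_) (trans (cong (λ b → p ^ suc b) b≡0) (*-identityʳ p)))
        rest≢1 : ∀ {q′} → q′ ∈ L′ → q′ % 4 ≢ 1
        rest≢1 {q′} q′∈ q′%4 with suc-part-1mod4 (∈-resp-↭ (↭-sym L↭) (there q′∈)) q′%4
        ... | b′ , eq = p∤2^e (∣-trans (subst (p ∣_) (sym eq) (∣n⇒∣m*n 2 (m∣m*n (p ^ b′))))
               (subst (suc q′ ∣_) 2p^bY′≡2^e (∣n⇒∣m*n (2 * p ^ b) (∈⇒∣product (∈-map⁺ suc q′∈)))))
        rest∤ : ∀ {s} → Prime s → s % 4 ≡ 1 → ¬ s ∣ product L′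
        rest∤ {s} ps s%4 s∣ with prime∣product ps L′ s∣
        ... | q′ , q′∈ , s∣q′ with isComp (∈-resp-↭ (↭-sym L↭) (there q′∈))
        ...   | t , l′ , pt , refl with prime∣prime ps pt (prime∣^ ps t (2 ^ l′) s∣q′)
        ...     | refl = rest≢1 q′∈ (pow-mod1 4 s s%4 (2 ^ l′))
        only : ∀ {s} → Prime s → s ∣ U → s ≡ r
        only {s} ps s∣U with divisor ps s∣U
        ... | _ , s%4 , s∣N with euclidsLemma q (product L′) ps (subst (s ∣_) N≡′ s∣N)
        ...   | inj₁ s∣q = prime∣prime ps pr (prime∣^ ps r (2 ^ l) s∣q)
        ...   | inj₂ s∣Y = contradiction s∣Y (rest∤ ps s%4)
        r∤2 : ¬ r ∣ 2
        r∤2 r∣2 = odd⇒2∤ r r-odd (∣-reflexive (sym (prime∣prime pr prime[2] r∣2)))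
        r∤suc-p : ¬ r ∣ suc p
        r∤suc-p r∣ = case subst (λ r → r % 4 ≡ 1) (prime∣prime pr prime[3] r∣3) r%4 of λ ()
          where
          r∣3 : r ∣ 3
          r∣3 = ∣m+n∣m⇒∣n (subst (r ∣_) (trans (*-suc 2 p) (trans (cong (2 +_) (sym 1+q≡2p)) (+-comm 3 q))) (∣n⇒∣m*n 2 r∣))
                  (n∣n^ r (2 ^ l) {{m^n≢0 2 l}})
        U≡q : U ≡ q
        U≡q with split-power pr U
        ... | a , m , U≡ , r∤m = trans U≡r^a (cong (r ^_) a≡)
          where
          m≡1 : m ≡ 1
          m≡1 = no-prime-divisor⇒1 {{∤⇒NonZero r∤m}} λ {s} ps s∣m →
            r∤m (subst (_∣ m) (only ps (subst (s ∣_) (sym U≡) (∣n⇒∣m*n (r ^ a) s∣m))) s∣m)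
          U≡r^a : U ≡ r ^ a
          U≡r^a = trans U≡ (trans (cong (r ^ a *_) m≡1) (*-identityʳ (r ^ a)))
          a≡ : a ≡ 2 ^ l
          a≡ = power-part pr (prime∤⇒∤* pr c (suc p) (c∤ pr r%4) r∤suc-p) (prime∤⇒∤* pr 2 (product L′) r∤2 (rest∤ pr r%4))
            (trans (cong (_* (c * suc p)) (sym U≡r^a)) (trans U*≡2N (trans (cong (2 *_) N≡′) (lemma 2 q (product L′)))))
            where
            lemma : ∀ x y z → x * (y * z) ≡ y * (x * z)
            lemma = solve-∀
        final : ⊥
        final with prime-power-Σbits pr r-odd {4} (s≤s (s≤s z≤n)) bh U≢1 only
        ... | k , U≡ = case subst (λ p → p % 4 ≡ 1) (sym (prime∣prime prime[3] pp (m%n≡0⇒n∣m p 3 p%3))) p%4 of λ ()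
          where
          j : ℕ
          j = pred (2 ^ k)
          p≡ : p ≡ 1 + 2 * 4 ^ j
          -- From 2p = 1 + q = 2 + 4 ^ 2 ^ k; modulo 3 this makes p equal to 1 + 2 = 0.
          p≡ = *-cancelˡ-≡ p _ 2 (begin
            2 * p                  ≡⟨ 1+q≡2p ⟨
            suc q                  ≡⟨ cong suc (trans (sym U≡q) U≡) ⟩
            2 + 4 ^ (2 ^ k)        ≡⟨ cong (λ n → 2 + 4 ^ n) (suc-pred (2 ^ k) {{m^n≢0 2 k}}) ⟨
            2 + 4 * 4 ^ j          ≡⟨ lemma (4 ^ j) ⟩
            2 * (1 + 2 * 4 ^ j)    ∎)
            where
            open ≡-Reasoning
            lemma : ∀ x → 2 + 4 * x ≡ 2 * (1 + 2 * x)
            lemma = solve-∀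
          p%3 : p % 3 ≡ 0
          p%3 = trans (cong (_% 3) p≡) (add-mod 3 1 (2 * 4 ^ j) refl (mul-mod 3 2 (4 ^ j) refl (4^%3 j)))

    σ₄≡1⇒ : ∀ {h} (bh : Bits h) → Σbits 4 bh ≡ 1 → 4 ^ h ≡ 1
    σ₄≡1⇒ {h} bh eq = ≤-antisym (subst (4 ^ h ≤_) eq (Σbits≥ 4 bh)) (m^n>0 4 h)

    -- Two odd components would give 4 ∣ M, so N is a single component q = 2p - 1. Then 3(p + 1) =
    -- 2(2p - 1) yields p = 5 and N = 9.
    single : M ≡ 2 * p → 3 * suc p ≡ 2 * N → N ≡ 9
    single M≡2p 2N = go L refl
      where
      odd-part : ∀ {q} → q ∈ L → 2 ∣ suc q
      odd-part {q} q∈ with half-cases q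
      ... | h , inj₁ refl = contradiction (∣-trans (m∣m*n h) (∈⇒∣product q∈)) 2∤N
      ... | h , inj₂ refl = divides (suc h) (lemma h)
        where
        lemma : ∀ h → 2 + 2 * h ≡ suc h * 2
        lemma = solve-∀
      go : ∀ L′ → L′ ≡ L → N ≡ 9
      go [] refl = case subst (2 ∣_) refl 2∣M of λ 2∣1 → case ∣1⇒≡1 2∣1 of λ ()
      go (q ∷ []) refl = trans (*-identityʳ q) (suc-injective (trans 1+q≡ (cong (2 *_) p≡5)))
        where
        1+q≡ : suc q ≡ 2 * p
        1+q≡ = trans (sym (*-identityʳ (suc q))) M≡2p
        p≡5 : p ≡ 5
        p≡5 = +-cancelʳ-≡ (3 * p) p 5 (begin
          p + 3 * p            ≡⟨ l₁ p ⟩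
          2 * (2 * p)          ≡⟨ cong (2 *_) 1+q≡ ⟨
          2 * suc q            ≡⟨ l₂ q ⟩
          2 + 2 * (q * 1)      ≡⟨ cong (2 +_) 2N ⟨
          2 + 3 * suc p        ≡⟨ l₃ p ⟩
          5 + 3 * p            ∎)
          where
          open ≡-Reasoning
          l₁ : ∀ p → p + 3 * p ≡ 2 * (2 * p)
          l₁ = solve-∀
          l₂ : ∀ q → 2 * suc q ≡ 2 + 2 * (q * 1)
          l₂ = solve-∀
          l₃ : ∀ p → 2 + 3 * suc p ≡ 5 + 3 * p
          l₃ = solve-∀
      go (q ∷ q′ ∷ L″) refl = contradiction (*-cancelˡ-∣ 2 (subst (4 ∣_) (trans (*-assoc (suc q) (suc q′) _) M≡2p)
        (∣m⇒∣m*n _ (*-pres-∣ (odd-part (here refl)) (odd-part (there (here refl))))))) 2∤p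

    N≡9 : N ≡ 9
    N≡9 with halve 2 be
    ... | even {h} bh _ 2^e≡ σe≡ with Σbits 4 bh ≟ 1
    ...   | no U≢1 = ⊥-elim (U-absurd bh 1 (λ pr _ r∣1 → ¬prime[1] (subst Prime (∣1⇒≡1 r∣1) pr)) (trans σe≡ (sym (*-identityˡ _))) U≢1)
    ...   | yes U≡1 = contradiction (subst (2 ∣_) (trans M≡2^e*p (trans (cong (_* p) (trans 2^e≡ (σ₄≡1⇒ bh U≡1))) (*-identityˡ p))) 2∣M) 2∤p
    N≡9 | odd {h} bh _ 2^e≡ σe≡ with Σbits 4 bh ≟ 1
    ...   | no U≢1 = ⊥-elim (U-absurd bh 3 (λ {r} pr r%4 r∣3 → case subst (λ r → r % 4 ≡ 1) (prime∣prime pr prime[3] r∣3) r%4 of λ ()) σe≡ U≢1)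
    ...   | yes U≡1 = single (trans M≡2^e*p (cong (_* p) (trans 2^e≡ (cong (2 *_) (σ₄≡1⇒ bh U≡1)))))
                        (trans (cong (_* suc p) (sym (trans σe≡ (cong (3 *_) U≡1)))) 2N≡)

  -- For odd f the lowest digit contributes the even factor p + 1 to 2N; a further digit of f would
  -- contribute a second even factor, against 4 ∤ 2N. Hence f = 1.
  N≡9 : N ≡ 9
  N≡9 with halve p bf
  ... | even bk _ p^f≡ σf≡ = ⊥-elim (EvenF.absurd bk p^f≡ σf≡)
  ... | odd {k} bk _ p^f≡ σf≡ with Σbits-unit-or-even (odd*odd {p} p-odd) bk
  ...   | inj₁ (σ≡1 , pow≡1) = OddF.N≡9 (trans M≡ (cong (2 ^ e *_) (trans p^f≡ (trans (cong (p *_) pow≡1) (*-identityʳ p)))))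
            (trans (cong (Σbits 2 be *_) (sym (trans σf≡ (trans (cong (suc p *_) σ≡1) (*-identityʳ (suc p)))))) N≡)
  ...   | inj₂ 2∣σ = contradiction (subst (4 ∣_) (trans (cong (Σbits 2 be *_) (sym σf≡)) N≡)
            (∣n⇒∣m*n (Σbits 2 be) (*-pres-∣ (2∣suc-odd {p} p-odd) 2∣σ))) 4∤2N

-- Even N: general part.

square-power : ∀ {r x} → r ∣ 2 + x → ∀ c → ∃[ z ] suc x ^ (2 * c) ≡ 1 + z * r
square-power r∣ zero = 0 , refl
square-power {r} {x} r∣@(divides w 2+x≡) (suc c) with square-power {r} {x} r∣ c
-- The hypothesis says that `suc x` is -1 modulo `r`; its square is `1 + x * (2 + x)`, which is 1
-- modulo `r`.
... | z , eq = x * w * (1 + z * r) + z , (begin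
  suc x ^ (2 * suc c)                  ≡⟨ ^-double (suc x) (suc c) ⟩
  suc x * suc x * (suc x * suc x) ^ c  ≡⟨ cong₂ _*_ (l₁ x) (trans (sym (^-double (suc x) c)) eq) ⟩
  (1 + x * (2 + x)) * (1 + z * r)      ≡⟨ cong (λ y → (1 + x * y) * (1 + z * r)) 2+x≡ ⟩
  (1 + x * (w * r)) * (1 + z * r)      ≡⟨ l₂ x w z r ⟩
  1 + (x * w * (1 + z * r) + z) * r    ∎)
  where
  open ≡-Reasoning
  l₁ : ∀ x → suc x * suc x ≡ 1 + x * (2 + x)
  l₁ = solve-∀
  l₂ : ∀ x w z r → (1 + x * (w * r)) * (1 + z * r) ≡ 1 + (x * w * (1 + z * r) + z) * r
  l₂ = solve-∀

-- `G` is the only component of N that is a power of 2, and it determines p as `suc G`. Indexing by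
-- `G` turns p into a numeral in the small cases.
record EvenCase (G : ℕ) : Set where
  field
    {g e f} : ℕ
    {L L′}  : List ℕ
    pp        : Prime (suc G)
    p-odd     : suc G % 2 ≡ 1
    G≡        : G ≡ 2 ^ g
    isComp    : ∀ {q} → q ∈ L → IsComp q
    M≡        : product (map suc L) ≡ 2 ^ e * suc G ^ f
    be        : Bits e
    bf        : Bits f
    N≡        : Σbits 2 be * Σbits (suc G) bf ≡ 2 * product L
    L↭        : L ↭ G ∷ L′
    L′-unique : Unique L′
    rest-odd  : ∀ {q} → q ∈ L′ → q % 2 ≡ 1
    2∣M       : 2 ∣ product (map suc L)

module EvenCaseProperties {G} (S : EvenCase G) where
  open EvenCase S
  open Parts pp p-odd isComp {e} {f} M≡ public

  p Y Y′ : ℕ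
  p = suc G
  Y = product L′
  Y′ = product (map suc L′)

  M≡′ : p * Y′ ≡ 2 ^ e * p ^ f
  M≡′ = trans (sym (product-↭ (Perm.map⁺ suc L↭))) M≡

  N≡′ : Σbits 2 be * Σbits p bf ≡ 2 * (G * Y)
  N≡′ = trans N≡ (cong (2 *_) (product-↭ L↭))

  in-L : ∀ {q} → q ∈ L′ → q ∈ L
  in-L q∈ = ∈-resp-↭ (↭-sym L↭) (there q∈)

  p∤2^ : ∀ n → ¬ p ∣ 2 ^ n
  p∤2^ n p∣ = 2∤p (∣-reflexive (sym (prime∣prime pp prime[2] (prime∣^ pp 2 n p∣))))

  odd-prime∤2^ : ∀ {r} → Prime r → r % 2 ≡ 1 → ∀ n → ¬ r ∣ 2 ^ n
  odd-prime∤2^ {r} pr r-odd n r∣ = odd⇒2∤ r r-odd (∣-reflexive (sym (prime∣prime pr prime[2] (prime∣^ pr 2 n r∣))))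

  prime-part-rest : ∀ {r} → Prime r → r ∣ Y → ∃[ l ] r ^ (2 ^ l) ∈ L′
  prime-part-rest pr = prime-part-of pr L′ (isComp ∘ in-L)

  ∣2N⇒∣Y : ∀ {r} → Prime r → r % 2 ≡ 1 → r ∣ Σbits 2 be * Σbits p bf → r ∣ Y
  ∣2N⇒∣Y {r} pr r-odd r∣ with euclidsLemma 2 (G * Y) pr (subst (r ∣_) N≡′ r∣)
  ... | inj₁ r∣2 = contradiction r∣2 (odd-prime∤2^ pr r-odd 1)
  ... | inj₂ r∣GY with euclidsLemma G Y pr r∣GY
  ...   | inj₁ r∣G = contradiction (subst (r ∣_) G≡ r∣G) (odd-prime∤2^ pr r-odd g)
  ...   | inj₂ r∣Y = r∣Y

  odd-part : ∀ {r} → Prime r → r % 2 ≡ 1 → r ∣ Σbits 2 be * Σbits p bf → ∃[ l ] r ^ (2 ^ l) ∈ L′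
  odd-part pr r-odd r∣ = prime-part-rest pr (∣2N⇒∣Y pr r-odd r∣)

  ∈L′⇒∣2N : ∀ {q} → q ∈ L′ → q ∣ Σbits 2 be * Σbits p bf
  ∈L′⇒∣2N {q} q∈ = subst (q ∣_) (sym N≡′) (∣n⇒∣m*n 2 (∣n⇒∣m*n G (∈⇒∣product q∈)))

  prime-of : ∀ {q} → q ∈ L′ → ∃[ r ] ∃[ l ] Prime r × r % 2 ≡ 1 × q ≡ r ^ (2 ^ l) × r ∣ Σbits 2 be * Σbits p bf
  prime-of q∈ with isComp (in-L q∈)
  ... | r , l , pr , refl = r , l , pr , r-odd , refl , ∣-trans r∣q (∈L′⇒∣2N q∈)
    where
    r∣q : r ∣ r ^ (2 ^ l)
    r∣q = n∣n^ r (2 ^ l) {{m^n≢0 2 l}}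
    r-odd : r % 2 ≡ 1
    r-odd with 2-or-odd pr
    ... | inj₂ eq = eq
    ... | inj₁ refl = contradiction r∣q (odd⇒2∤ _ (rest-odd q∈))

  -- The exponent of p in M would be odd.
  even-exponents⇒⊥ : (∀ {q} → q ∈ L′ → ∃[ b ] suc q ≡ 2 * p ^ (2 * b)) → ∀ {k} → f ≡ 2 * k → ⊥
  even-exponents⇒⊥ form {k} f≡ with collect L′ form
    where
    collect : ∀ xs → (∀ {q} → q ∈ xs → ∃[ b ] suc q ≡ 2 * p ^ (2 * b)) → ∃[ n ] ∃[ m ] product (map suc xs) ≡ 2 ^ n * p ^ (2 * m)
    collect [] _ = 0 , 0 , refl
    collect (q ∷ xs) form with form (here refl) | collect xs (form ∘ there)
    ... | b , eq | n , m , eq′ = suc n , b + m , trans (cong₂ _*_ eq eq′) (trans (lemma (p ^ (2 * b)) (2 ^ n) (p ^ (2 * m)))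
        (cong (2 ^ suc n *_) (trans (sym (^-distribˡ-+-* p (2 * b) (2 * m))) (cong (p ^_) (sym (*-distribˡ-+ 2 b m))))))
      where
      lemma : ∀ x y z → 2 * x * (y * z) ≡ 2 * y * (x * z)
      lemma = solve-∀
  ... | n , m , Y′≡ = even≢odd k m (trans (sym f≡) (power-part pp (p∤2^ e) (p∤2^ n)
      (trans (*-comm (p ^ f) (2 ^ e)) (trans (sym M≡′) (trans (cong (p *_) Y′≡) (lemma p (2 ^ n) (p ^ (2 * m))))))))
    where
    lemma : ∀ p x y → p * (x * y) ≡ p * y * x
    lemma = solve-∀

  module SquareBits {h k} (bh : Bits h) (bk : Bits k) (2N≡ : Σbits 2 be * Σbits p bf ≡ Σbits 4 bh * Σbits (p * p) bk) where
    q%4 : ∀ {q} → q ∈ L′ → q % 4 ≡ 1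
    q%4 q∈ with prime-of q∈
    ... | r , l , pr , r-odd , refl , r∣ = pow-mod1 4 r r%4 (2 ^ l)
      where
      r%4 : r % 4 ≡ 1
      r%4 with euclidsLemma (Σbits 4 bh) (Σbits (p * p) bk) pr (subst (r ∣_) 2N≡ r∣)
      ... | inj₁ d = ∣Σbits⇒1mod4 pr r-odd 2 bh d
      ... | inj₂ d = ∣Σbits⇒1mod4 pr r-odd p bk d

  9∣3^ : ∀ l → 9 ∣ 3 ^ (2 ^ suc l)
  9∣3^ l = subst (9 ∣_) (sym (^-double 3 (2 ^ l))) (n∣n^ 9 (2 ^ l) {{m^n≢0 2 l}})

  3²^%4 : ∀ l → 3 ^ (2 ^ suc l) % 4 ≡ 1
  3²^%4 l = trans (cong (_% 4) (^-double 3 (2 ^ l))) (pow-mod1 4 9 refl (2 ^ l))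

  -- The component 3 of N and the component 2 of M contribute (4/3)(3/2) = 2, and `G` in N
  -- contributes a further p / G > 1.
  3-and-odd-e : 3 ∈ L′ → ∀ {h} (bh : Bits h) → 2 ^ e ≡ 2 * 4 ^ h → Σbits 2 be ≡ 3 * Σbits 4 bh → ⊥
  3-and-odd-e 3∈ {h} bh 2^e≡ σe≡ with extract 3∈ L′-unique
  ... | L″ , L′↭ , _ = density′ (6 * G) 3 (4 * p) 2 L″ 4 bh p bf (s≤s z≤n) αδ≤βγ
    (≤-trans (s≤s (s≤s (s≤s z≤n))) (*-monoʳ-≤ 4 (s≤s (z≤n {G}))))
    (begin
      6 * G * product L″                   ≡⟨ l₁ G (product L″) ⟩
      2 * (G * (3 * product L″))           ≡⟨ cong (λ y → 2 * (G * y)) (product-↭ L′↭) ⟨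
      2 * (G * Y)                          ≡⟨ N≡′ ⟨
      Σbits 2 be * Σbits p bf              ≡⟨ cong (_* Σbits p bf) σe≡ ⟩
      3 * Σbits 4 bh * Σbits p bf          ≡⟨ *-assoc 3 (Σbits 4 bh) _ ⟩
      3 * (Σbits 4 bh * Σbits p bf)        ∎)
    (begin
      4 * p * product (map suc L″)         ≡⟨ l₂ p (product (map suc L″)) ⟩
      p * (4 * product (map suc L″))       ≡⟨ cong (p *_) (product-↭ (Perm.map⁺ suc L′↭)) ⟨
      p * Y′                               ≡⟨ M≡′ ⟩
      2 ^ e * p ^ f                        ≡⟨ cong (_* p ^ f) 2^e≡ ⟩
      2 * 4 ^ h * p ^ f                    ≡⟨ *-assoc 2 (4 ^ h) _ ⟩
      2 * (4 ^ h * p ^ f)                  ∎)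
    where
    open ≡-Reasoning
    l₁ : ∀ G y → 6 * G * y ≡ 2 * (G * (3 * y))
    l₁ = solve-∀
    l₂ : ∀ p y → 4 * p * y ≡ p * (4 * y)
    l₂ = solve-∀
    l₃ : ∀ G → 12 + 6 * G * 2 ≡ 3 * (4 * suc G)
    l₃ = solve-∀
    αδ≤βγ : 6 * G * 2 ≤ 3 * (4 * p)
    αδ≤βγ = subst (6 * G * 2 ≤_) (l₃ G) (m≤n+m (6 * G * 2) 12)

  module _ (p%3 : p % 3 ≡ 2) where
    p²%3 : (p * p) % 3 ≡ 1
    p²%3 = mul-mod 3 p p p%3 p%3

    3∣p+1 : 3 ∣ suc p
    3∣p+1 = m%n≡0⇒n∣m (suc p) 3 (add-mod 3 1 p refl p%3)

    2p^even%3 : ∀ h → (2 * p ^ (2 * h)) % 3 ≡ 2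
    2p^even%3 h = mul-mod 3 2 (p ^ (2 * h)) refl (trans (cong (_% 3) (^-double p h)) (pow-mod1 3 (p * p) p²%3 h))

    2p^odd%3 : ∀ h → (2 * p ^ (1 + 2 * h)) % 3 ≡ 1
    2p^odd%3 h = mul-mod 3 2 (p ^ (1 + 2 * h)) refl (mul-mod 3 p (p ^ (2 * h)) p%3
      (trans (cong (_% 3) (^-double p h)) (pow-mod1 3 (p * p) p²%3 h)))

    -- For odd b, 2p ^ b is 1 modulo 3, which would make q divisible by 3.
    even-exponent : ∀ {q} → q ∈ L′ → q % 4 ≡ 1 → ¬ 3 ∣ q → ∃[ b ] suc q ≡ 2 * p ^ (2 * b)
    even-exponent {q} q∈ q%4 3∤q with suc-part-1mod4 (in-L q∈) q%4
    ... | b , eq with half-cases (suc b)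
    ...   | h , inj₁ 1+b≡ = h , trans eq (cong (λ b → 2 * p ^ b) 1+b≡)
    ...   | h , inj₂ 1+b≡ = contradiction (m%n≡0⇒n∣m q 3 (cases (m%n<n q 3) (trans (sym (%-distribˡ-+ 1 q 3))
              (trans (cong (_% 3) (trans eq (cong (λ b → 2 * p ^ b) 1+b≡))) (2p^odd%3 h))))) 3∤q
      where
      cases : ∀ {c} → c < 3 → (1 + c) % 3 ≡ 1 → c ≡ 0
      cases = toWitness {a? = allUpTo? (λ c → ((1 + c) % 3 ≟ 1) →-dec (c ≟ 0)) 3} tt

    -- If e is even too, 2N is a product of numbers `y² + 1`, so 3 divides no component and all
    -- exponents of p in the `1 + q` are even. If e is odd, 2N has exactly one factor 3, so the
    -- component of N at the prime 3 is 3 itself.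
    even-f⇒⊥ : ∀ {k} (bk : Bits k) → f ≡ 2 * k → Σbits p bf ≡ Σbits (p * p) bk → ⊥
    even-f⇒⊥ {k} bk f≡ σf≡ with halve 2 be
    ... | even bh _ _ σe≡ = even-exponents⇒⊥ (λ q∈ → even-exponent q∈ (q%4 q∈) λ 3∣q →
            prime∤⇒∤* prime[3] _ _ (3∤Σbits 2 bh) (3∤Σbits p bk) (subst (3 ∣_) 2N≡ (∣-trans 3∣q (∈L′⇒∣2N q∈)))) {k} f≡
      where
      2N≡ : Σbits 2 be * Σbits p bf ≡ Σbits 4 bh * Σbits (p * p) bk
      2N≡ = cong₂ _*_ σe≡ σf≡
      open SquareBits bh bk 2N≡
    ... | odd bh _ 2^e≡ σe≡ = go (odd-part prime[3] refl (subst (3 ∣_) (sym 2N≡) (m∣m*n (Σbits 4 bh * Σbits (p * p) bk))))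
      where
      2N≡ : Σbits 2 be * Σbits p bf ≡ 3 * (Σbits 4 bh * Σbits (p * p) bk)
      2N≡ = trans (cong₂ _*_ σe≡ σf≡) (*-assoc 3 (Σbits 4 bh) _)
      go : ∃[ l ] 3 ^ (2 ^ l) ∈ L′ → ⊥
      go (zero , 3∈) = 3-and-odd-e 3∈ bh 2^e≡ σe≡
      go (suc l , q∈) = prime∤⇒∤* prime[3] _ _ (3∤Σbits 2 bh) (3∤Σbits p bk)
        (*-cancelˡ-∣ 3 (subst (9 ∣_) 2N≡ (∣-trans (9∣3^ l) (∈L′⇒∣2N q∈))))

    module OddF {k} (bk : Bits k) (p^f≡ : p ^ f ≡ p * (p * p) ^ k) (σf≡ : Σbits p bf ≡ suc p * Σbits (p * p) bk) where
      3-part : ∃[ l ] 3 ^ (2 ^ l) ∈ L′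
      3-part = odd-part prime[3] refl (subst (3 ∣_) (cong (Σbits 2 be *_) (sym σf≡)) (∣n⇒∣m*n (Σbits 2 be) (∣m⇒∣m*n (Σbits (p * p) bk) 3∣p+1)))

      -- A power of 16 gives p ≡ 2 mod 5 and p ≥ 17; for p = 5 both fail.
      module Large {j} (G≡16 : G ≡ 16 * 16 ^ j) where
        p%5 : p % 5 ≡ 2
        p%5 = trans (cong (λ G → suc G % 5) G≡16) (add-mod 5 1 (16 ^ suc j) refl (pow-mod1 5 16 refl (suc j)))

        2p^odd%5 : ∀ h → (2 * p ^ (1 + 2 * h)) % 5 ≢ 2
        2p^odd%5 h eq with 4^-cases h
          where
          4^-cases : ∀ h → (p * p) ^ h % 5 ≡ 1 ⊎ (p * p) ^ h % 5 ≡ 4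
          4^-cases zero = inj₁ refl
          4^-cases (suc h) with 4^-cases h
          ... | inj₁ eq = inj₂ (mul-mod 5 (p * p) ((p * p) ^ h) (mul-mod 5 p p p%5 p%5) eq)
          ... | inj₂ eq = inj₁ (mul-mod 5 (p * p) ((p * p) ^ h) (mul-mod 5 p p p%5 p%5) eq)
        ... | inj₁ eq′ = case trans (sym eq) (mul-mod 5 2 (p ^ (1 + 2 * h)) refl (mul-mod 5 p (p ^ (2 * h)) p%5
                           (trans (cong (_% 5) (^-double p h)) eq′))) of λ ()
        ... | inj₂ eq′ = case trans (sym eq) (mul-mod 5 2 (p ^ (1 + 2 * h)) refl (mul-mod 5 p (p ^ (2 * h)) p%5
                           (trans (cong (_% 5) (^-double p h)) eq′))) of λ ()

        17≤p : 17 ≤ p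
        17≤p = s≤s (subst (16 ≤_) (sym G≡16) (m≤m*n 16 (16 ^ j) {{m^n≢0 16 j}}))

        -- In 1 + q = 2p ^ b an even b fails modulo 3. An odd b fails modulo 5 when q is a power of
        -- 81, and by size when q = 9.
        3²^∉L′ : ∀ l → ¬ 3 ^ (2 ^ suc l) ∈ L′
        3²^∉L′ l q∈ with suc-part-1mod4 (in-L q∈) (3²^%4 l)
        ... | b , eq with half-cases (suc b)
        ...   | h , inj₁ 1+b≡ = case trans (sym (2p^even%3 h)) (trans (cong (_% 3) (trans (cong (λ b → 2 * p ^ b) (sym 1+b≡)) (sym eq)))
                  (add-mod 3 1 (3 ^ (2 ^ suc l)) refl (n∣m⇒m%n≡0 _ 3 (n∣n^ 3 (2 ^ suc l) {{m^n≢0 2 (suc l)}})))) of λ ()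
        ...   | h , inj₂ 1+b≡ = odd-exponent l eq
          where
          odd-exponent : ∀ l → suc (3 ^ (2 ^ suc l)) ≡ 2 * p ^ suc b → ⊥
          odd-exponent zero eq = <-irrefl eq (begin-strict
            10               <⟨ m≤m+n 11 23 ⟩
            2 * 17           ≤⟨ *-monoʳ-≤ 2 17≤p ⟩
            2 * p            ≤⟨ *-monoʳ-≤ 2 (m≤m*n p (p ^ b) {{m^n≢0 p b}}) ⟩
            2 * p ^ suc b    ∎)
            where open ≤-Reasoning
          odd-exponent (suc l) eq = 2p^odd%5 h (trans (cong (_% 5) (trans (cong (λ b → 2 * p ^ b) (sym 1+b≡)) (sym eq)))
            (add-mod 5 1 (3 ^ (2 ^ (2 + l))) refl (trans (cong (_% 5) (trans (^-double 3 (2 ^ suc l)) (^-double 9 (2 ^ l))))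
              (pow-mod1 5 81 refl (2 ^ l)))))

        3∈L′ : 3 ∈ L′
        3∈L′ with 3-part
        ... | zero , 3∈ = 3∈
        ... | suc l , q∈ = contradiction q∈ (3²^∉L′ l)

        -- (p + 1) / 6 = (1 + 8 · 16 ^ j) / 3
        third : ∃[ m ] 1 + 8 * 16 ^ j ≡ 3 * m × m % 4 ≡ 3
        third = go j
          where
          go : ∀ j → ∃[ m ] 1 + 8 * 16 ^ j ≡ 3 * m × m % 4 ≡ 3
          go zero = 3 , refl , refl
          go (suc j) with go j
          ... | m , eq , m%4 = m + (10 * 16 ^ j) * 4 , trans (l₁ (16 ^ j)) (trans (cong (_+ 120 * 16 ^ j) eq) (l₂ m (16 ^ j))) ,
                trans ([m+kn]%n≡m%n m (10 * 16 ^ j) 4) m%4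
            where
            l₁ : ∀ x → 1 + 8 * (16 * x) ≡ 1 + 8 * x + 120 * x
            l₁ = solve-∀
            l₂ : ∀ m x → 3 * m + 120 * x ≡ 3 * (m + (10 * x) * 4)
            l₂ = solve-∀

        p+1≡ : suc p ≡ 2 * (1 + 8 * 16 ^ j)
        p+1≡ = trans (cong (2 +_) G≡16) (lemma (16 ^ j))
          where
          lemma : ∀ x → 2 + 16 * x ≡ 2 * (1 + 8 * x)
          lemma = solve-∀

        -- The prime `r` divides p + 1 and hence 2N, so it must occur in a component of N. The cases
        -- below show that no such component can have `1 + q` of the form 2 ^ a p ^ b.
        module Residue {m r} (1+8·16^j≡ : 1 + 8 * 16 ^ j ≡ 3 * m) (m%4 : m % 4 ≡ 3)
          (pr : Prime r) (r∣m : r ∣ m) (r%4 : r % 4 ≡ 3) where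
          p+1≡6m : suc p ≡ 2 * (3 * m)
          p+1≡6m = trans p+1≡ (cong (2 *_) 1+8·16^j≡)
          m≢0 : NonZero m
          m≢0 = ≢-nonZero λ { refl → case m%4 of λ () }
          r-odd : r % 2 ≡ 1
          r-odd = %-% 2 4 (divides 2 refl) r r%4
          r∣p+1 : r ∣ suc p
          r∣p+1 = subst (r ∣_) (sym p+1≡6m) (∣n⇒∣m*n 2 (∣n⇒∣m*n 3 r∣m))
          p+1∣2N : suc p ∣ Σbits 2 be * Σbits p bf
          p+1∣2N = ∣n⇒∣m*n (Σbits 2 be) (subst (suc p ∣_) (sym σf≡) (m∣m*n (Σbits (p * p) bk)))
          r-part : ∃[ l ] r ^ (2 ^ l) ∈ L′
          r-part = odd-part pr r-odd (∣-trans r∣p+1 p+1∣2N)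
          -- Then 9 divides p + 1 and so 2N, but the component 3 supplies one factor 3 and higher
          -- components at 3 are excluded.
          case-3 : 3 ∣ m → ⊥
          case-3 3∣m with extract 3∈L′ L′-unique
          ... | L″ , L′↭ , (3∉ ∷ _) = dup
            where
            9∣p+1 : 3 * 3 ∣ suc p
            9∣p+1 = subst (3 * 3 ∣_) (sym p+1≡6m) (∣n⇒∣m*n 2 (*-monoʳ-∣ 3 3∣m))
            2N≡″ : Σbits 2 be * Σbits p bf ≡ 3 * (2 * G * product L″)
            2N≡″ = trans N≡′ (trans (cong (λ y → 2 * (G * y)) (product-↭ L′↭)) (lemma G (product L″)))
              where
              lemma : ∀ G y → 2 * (G * (3 * y)) ≡ 3 * (2 * G * y)
              lemma = solve-∀
            9∣GY : 3 * 3 ∣ 3 * (2 * G * product L″)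
            9∣GY = subst (3 * 3 ∣_) 2N≡″ (∣-trans 9∣p+1 p+1∣2N)
            3∣Y″ : 3 ∣ product L″
            3∣Y″ = euclidʳ prime[3] (2 * G) (product L″)
              (λ d → odd-prime∤2^ prime[3] refl (suc g) (subst (λ G → 3 ∣ 2 * G) G≡ d)) (*-cancelˡ-∣ 3 9∣GY)
            dup : ⊥
            dup = case prime-part-of prime[3] L″ (λ q∈ → isComp (in-L (∈-resp-↭ (↭-sym L′↭) (there q∈)))) 3∣Y″ of λ { (l , q∈) → exponent l q∈ }
              where
              exponent : ∀ l → ¬ 3 ^ (2 ^ l) ∈ L″
              exponent zero q∈ = All.lookup 3∉ q∈ refl
              exponent (suc l) q∈ = 3²^∉L′ l (∈-resp-↭ (↭-sym L′↭) (there q∈))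
          -- For l ≥ 1 the component q is 1 mod 4, so 1 + q = 2p ^ b with p ≡ -1 modulo `r`: even b
          -- gives q ≡ 1 and odd b gives q ≡ -3, against r ∣ q and r ≠ 3.
          case-r : r ≢ 3 → ∃[ l ] r ^ (2 ^ l) ∈ L′ → ⊥
          case-r r≢3 (suc l , q∈) = go (suc-part-1mod4 (in-L q∈) (trans (cong (_% 4) (^-double r (2 ^ l))) (pow-mod1 4 (r * r) (mul-mod 4 r r r%4 r%4) (2 ^ l))))
            where
            q : ℕ
            q = r ^ (2 ^ suc l)
            r∣q : r ∣ q
            r∣q = n∣n^ r (2 ^ suc l) {{m^n≢0 2 (suc l)}}
            go : ∃[ b ] suc q ≡ 2 * p ^ suc b → ⊥
            go (b , eq) = exponent-cases (half-cases (suc b))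
              where
              exponent-cases : ∃[ c ] (suc b ≡ 2 * c ⊎ suc b ≡ 1 + 2 * c) → ⊥
              exponent-cases (c , inj₁ 1+b≡) = even-b (square-power r∣p+1 c)
                where
                even-b : ∃[ z ] p ^ (2 * c) ≡ 1 + z * r → ⊥
                even-b (z , p^≡) = ¬prime[1] (subst Prime (∣1⇒≡1 (∣m+n∣m⇒∣n (subst (r ∣_) q≡ r∣q) (n∣m*n (2 * z)))) pr)
                  where
                  lemma : ∀ z r → 2 * (1 + z * r) ≡ suc (2 * z * r + 1)
                  lemma = solve-∀
                  q≡ : q ≡ 2 * z * r + 1
                  q≡ = suc-injective (trans eq (trans (cong (λ b → 2 * p ^ b) 1+b≡) (trans (cong (2 *_) p^≡) (lemma z r))))
              exponent-cases (c , inj₂ 1+b≡) = odd-b (square-power r∣p+1 c)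
                where
                odd-b : ∃[ z ] p ^ (2 * c) ≡ 1 + z * r → ⊥
                odd-b (z , p^≡) = r≢3 (prime∣prime pr prime[3] (∣m+n∣m⇒∣n (subst (r ∣_) (sym q+3≡)
                      (∣m∣n⇒∣m+n (∣n⇒∣m*n 2 r∣p+1) (n∣m*n (2 * p * z)))) r∣q))
                  where
                  l₁ : ∀ q → q + 3 ≡ 2 + suc q
                  l₁ = solve-∀
                  l₂ : ∀ p z r → 2 + 2 * (p * (1 + z * r)) ≡ 2 * suc p + 2 * p * z * r
                  l₂ = solve-∀
                  q+3≡ : q + 3 ≡ 2 * suc p + 2 * p * z * r
                  q+3≡ = trans (l₁ q) (trans (cong (2 +_) (trans eq (trans (cong (λ b → 2 * p ^ b) 1+b≡) (cong (λ x → 2 * (p * x)) p^≡)))) (l₂ p z r))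
          -- Here q = r. As r ≤ m = (p + 1)/6, the number 1 + r is too small to contain p, so r is a
          -- Mersenne prime dividing 2 ^ (3 + 4j) + 1.
          case-r r≢3 (zero , q∈) with suc-part (in-L q∈)
          ... | a , suc b , eq = <-irrefl refl (begin-strict
              p                            ≤⟨ m≤m*n p (p ^ b) {{m^n≢0 p b}} ⟩
              p ^ suc b                    ≤⟨ m≤n*m (p ^ suc b) (2 ^ a) {{m^n≢0 2 a}} ⟩
              2 ^ a * p ^ suc b            ≡⟨ eq ⟨
              suc (r ^ 1)                  ≡⟨ cong suc (*-identityʳ r) ⟩
              suc r                        ≤⟨ s≤s (∣⇒≤ {{m≢0}} r∣m) ⟩
              suc m                        <⟨ s≤s⁻¹ (begin-strict
                2 + m                        ≤⟨ m≤n+m (2 + m) 2 ⟩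
                4 + m                        ≤⟨ +-monoˡ-≤ m (*-monoʳ-≤ 4 (>-nonZero⁻¹ m {{m≢0}})) ⟩
                4 * m + m                    <⟨ m<m+n (4 * m + m) (>-nonZero⁻¹ m {{m≢0}}) ⟩
                4 * m + m + m                ≡⟨ lemma m ⟩
                2 * (3 * m)                  ≡⟨ p+1≡6m ⟨
                suc p                        ∎) ⟩
              p                            ∎)
            where
            open ≤-Reasoning
            lemma : ∀ m → 4 * m + m + m ≡ 2 * (3 * m)
            lemma = solve-∀
          ... | a , zero , eq = mersenne a (trans (sym (cong suc (*-identityʳ r))) (trans eq (*-identityʳ (2 ^ a))))
            where
            mersenne : ∀ a → suc r ≡ 2 ^ a → ⊥
            mersenne 0 eq = case subst (λ r → r % 4 ≡ 3) (suc-injective eq) r%4 of λ ()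
            mersenne 1 eq = case subst (λ r → r % 4 ≡ 3) (suc-injective eq) r%4 of λ ()
            mersenne 2 eq = r≢3 (suc-injective eq)
            mersenne a@(suc (2+ _)) eq = mersenne∤2^+1 r a (s≤s (s≤s (s≤s z≤n))) eq (3 + 4 * j)
              (subst (r ∣_) (trans (sym 1+8·16^j≡) 1+8·16^j≡2^) (∣n⇒∣m*n 3 r∣m))
              where
              1+8·16^j≡2^ : 1 + 8 * 16 ^ j ≡ 2 ^ (3 + 4 * j) + 1
              1+8·16^j≡2^ = trans (+-comm 1 (8 * 16 ^ j)) (cong (_+ 1) (trans (cong (8 *_) (^-*-assoc 2 4 j)) (sym (^-distribˡ-+-* 2 3 (4 * j)))))
          contra : ⊥
          contra with r ≟ 3
          ... | yes refl = case-3 r∣m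
          ... | no r≢3 = case-r r≢3 r-part

        absurd : ⊥
        absurd with halve 2 be
        ... | odd bh _ 2^e≡ σe≡ = 3-and-odd-e 3∈L′ bh 2^e≡ σe≡
        ... | even {h} bh _ _ σe≡ with third
        ...   | m , 1+8·16^j≡ , m%4 with 3mod4-prime-factor m m%4
        ...     | r , pr , r∣m , r%4 = Residue.contra 1+8·16^j≡ m%4 pr r∣m r%4

-- Even N with p = 3.

module EvenCase-2 (S : EvenCase 2) where
  open EvenCase S
  open EvenCaseProperties S

  -- Since M is even and `c` odd, `X` is even; this supplies strictness where the density budget is
  -- met exactly.
  M-even : ∀ c X → ¬ 2 ∣ c → product (map suc L) ≡ c * X → 1 < X
  M-even c X 2∤c eq = ≤∧≢⇒< (n≢0⇒n>0 λ { refl → ≢-nonZero⁻¹ (product (map suc L)) {{M≢0}} (trans eq (*-zeroʳ c)) })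
                            (λ { refl → case ∣1⇒≡1 2∣X of λ () })
    where
    M≢0 : NonZero (product (map suc L))
    M≢0 = subst NonZero (sym M≡) (m*n≢0 (2 ^ e) (3 ^ f) {{m^n≢0 2 e}} {{m^n≢0 3 f}})
    2∣X : 2 ∣ X
    2∣X = euclidʳ prime[2] c X 2∤c (subst (2 ∣_) eq 2∣M)

  -- The component 2 occurs in both N and M: (3/2)(3/2) > 2.
  odd-e : ∀ {h} (bh : Bits h) → 2 ^ e ≡ 2 * 4 ^ h → Σbits 2 be ≡ 3 * Σbits 4 bh → ⊥
  odd-e {h} bh 2^e≡ σe≡ = density′ 4 3 3 2 L′ 4 bh 3 bf (s≤s z≤n) (m≤m+n 8 1) ≤-refl
    (begin
      4 * Y                            ≡⟨ *-assoc 2 2 Y ⟩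
      2 * (2 * Y)                      ≡⟨ N≡′ ⟨
      Σbits 2 be * Σbits 3 bf          ≡⟨ cong (_* Σbits 3 bf) σe≡ ⟩
      3 * Σbits 4 bh * Σbits 3 bf      ≡⟨ *-assoc 3 (Σbits 4 bh) _ ⟩
      3 * (Σbits 4 bh * Σbits 3 bf)    ∎)
    (trans M≡′ (trans (cong (_* 3 ^ f) 2^e≡) (*-assoc 2 (4 ^ h) _)))
    where open ≡-Reasoning

  -- 2 in N and 3 in M contribute (3/2)(4/3) = 2 exactly.
  odd-f : ∀ {h k} (bh : Bits h) (bk : Bits k) → 2 ^ e ≡ 4 ^ h → Σbits 2 be ≡ Σbits 4 bh →
          3 ^ f ≡ 3 * 9 ^ k → Σbits 3 bf ≡ 4 * Σbits 9 bk → ⊥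
  odd-f {h} {k} bh bk 2^e≡ σe≡ 3^f≡ σf≡ = density 4 4 3 3 L′ 4 bh 9 bk (s≤s z≤n) ≤-refl
    (M-even 3 X (odd⇒2∤ 3 refl) (trans M≡ (trans (cong₂ _*_ 2^e≡ 3^f≡) (lemma 3 (4 ^ h) (9 ^ k)))))
    (trans (*-assoc 2 2 Y) (trans (sym N≡′) (trans (cong₂ _*_ σe≡ σf≡) (lemma 4 (Σbits 4 bh) (Σbits 9 bk)))))
    (trans M≡′ (trans (cong₂ _*_ 2^e≡ 3^f≡) (lemma 3 (4 ^ h) (9 ^ k))))
    where
    X : ℕ
    X = 4 ^ h * 9 ^ k
    lemma : ∀ c x y → x * (c * y) ≡ c * (x * y)
    lemma = solve-∀

  -- A higher component 25 ^ 2 ^ l is 1 modulo 3, so 1 + q would not be divisible by 3.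
  5∈L′ : 5 ∣ Σbits 2 be * Σbits 3 bf → 5 ∈ L′
  5∈L′ 5∣ = go (odd-part prime[5] refl 5∣)
    where
    go : ∃[ l ] 5 ^ (2 ^ l) ∈ L′ → 5 ∈ L′
    go (zero , 5∈) = 5∈
    go (suc l , q∈) = contra (suc-part-1mod4 (in-L q∈) (pow-mod1 4 5 refl (2 ^ suc l)))
      where
      contra : ∃[ b ] suc (5 ^ (2 ^ suc l)) ≡ 2 * 3 ^ suc b → 5 ∈ L′
      contra (b , eq) = case trans (sym (add-mod 3 1 (5 ^ (2 ^ suc l)) refl (trans (cong (_% 3) (^-double 5 (2 ^ l))) (pow-mod1 3 25 refl (2 ^ l)))))
        (n∣m⇒m%n≡0 _ 3 (subst (3 ∣_) (sym eq) (∣n⇒∣m*n 2 (m∣m*n (3 ^ b))))) of λ ()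

  2N-without-5 : ∀ {L″} → L′ ↭ 5 ∷ L″ → 20 * product L″ ≡ Σbits 2 be * Σbits 3 bf
  2N-without-5 {L″} L′↭ = trans (lemma (product L″)) (trans (cong (λ y → 2 * (2 * y)) (sym (product-↭ L′↭))) (sym N≡′))
    where
    lemma : ∀ y → 20 * y ≡ 2 * (2 * (5 * y))
    lemma = solve-∀

  M-without-5 : ∀ {L″} → L′ ↭ 5 ∷ L″ → 18 * product (map suc L″) ≡ 2 ^ e * 3 ^ f
  M-without-5 {L″} L′↭ = trans (*-assoc 3 6 (product (map suc L″))) (trans (cong (3 *_) (sym (product-↭ (Perm.map⁺ suc L′↭)))) M≡′)

  -- The component 4 of M contributes 5 to 2N and so brings 5 into N: (3/2)(6/5)(5/4) > 2.
  2-mod-4-e : ∀ {h k} (bh : Bits h) (bk : Bits k) → 2 ^ e ≡ 4 * 16 ^ h → Σbits 2 be ≡ 5 * Σbits 16 bh →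
              3 ^ f ≡ 9 ^ k → Σbits 3 bf ≡ Σbits 9 bk → ⊥
  2-mod-4-e {h} bh bk 2^e≡ σe≡ 3^f≡ σf≡ = case extract (5∈L′ (subst (5 ∣_) (cong (_* Σbits 3 bf) (sym σe≡)) (∣m⇒∣m*n (Σbits 3 bf) (m∣m*n (Σbits 16 bh))))) L′-unique of
    λ { (L″ , L′↭ , _) → density′ 20 5 18 4 L″ 16 bh 9 bk (s≤s z≤n) (m≤m+n 80 10) (m≤m+n 5 13)
      (trans (2N-without-5 L′↭) (trans (cong₂ _*_ σe≡ σf≡) (*-assoc 5 (Σbits 16 bh) _)))
      (trans (M-without-5 L′↭) (trans (cong₂ _*_ 2^e≡ 3^f≡) (*-assoc 4 (16 ^ h) _))) }

  -- The component 9 of M contributes 10 to 2N and again brings 5 into N: (3/2)(6/5)(10/9) = 2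
  -- exactly.
  2-mod-4-f : ∀ {h k} (bh : Bits h) (bk : Bits k) → 2 ^ e ≡ 16 ^ h → Σbits 2 be ≡ Σbits 16 bh →
              3 ^ f ≡ 9 * 81 ^ k → Σbits 3 bf ≡ 10 * Σbits 81 bk → ⊥
  2-mod-4-f {h} {k} bh bk 2^e≡ σe≡ 3^f≡ σf≡ = case extract (5∈L′ (subst (5 ∣_) (cong (Σbits 2 be *_) (sym σf≡))
      (∣n⇒∣m*n (Σbits 2 be) (∣m⇒∣m*n (Σbits 81 bk) (divides 2 refl))))) L′-unique of
    λ { (L″ , L′↭ , _) → density 20 10 18 9 L″ 16 bh 81 bk (s≤s z≤n) ≤-refl
      (M-even 9 (16 ^ h * 81 ^ k) (odd⇒2∤ 9 refl) (trans M≡ (trans (cong₂ _*_ 2^e≡ 3^f≡) (lemma 9 (16 ^ h) (81 ^ k)))))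
      (trans (2N-without-5 L′↭) (trans (cong₂ _*_ σe≡ σf≡) (lemma 10 (Σbits 16 bh) (Σbits 81 bk))))
      (trans (M-without-5 L′↭) (trans (cong₂ _*_ 2^e≡ 3^f≡) (lemma 9 (16 ^ h) (81 ^ k)))) }
    where
    lemma : ∀ c x y → x * (c * y) ≡ c * (x * y)
    lemma = solve-∀

  -- Now 2N is a product of numbers `y⁴ + 1`, so every odd component is 1 mod 8. As 2 · 3 ^ b is 6
  -- modulo 8 for odd b, all exponents are even.
  0-mod-4 : ∀ {h k l} (bh : Bits h) (bk : Bits k) → Σbits 2 be ≡ Σbits 16 bh → Σbits 3 bf ≡ Σbits 81 bk → f ≡ 2 * l → ⊥
  0-mod-4 {l = l} bh bk σe≡ σf≡ f≡ = even-exponents⇒⊥ form {l} f≡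
    where
    q%8 : ∀ {q} → q ∈ L′ → q % 8 ≡ 1
    q%8 q∈ with prime-of q∈
    ... | r , l , pr , r-odd , refl , r∣ = pow-mod1 8 r r%8 (2 ^ l)
      where
      r%8 : r % 8 ≡ 1
      r%8 with euclidsLemma (Σbits 16 bh) (Σbits 81 bk) pr (subst (r ∣_) (cong₂ _*_ σe≡ σf≡) r∣)
      ... | inj₁ d = ∣Σbits⇒1mod8 pr r-odd 2 bh d
      ... | inj₂ d = ∣Σbits⇒1mod8 pr r-odd 3 bk d
    form : ∀ {q} → q ∈ L′ → ∃[ b ] suc q ≡ 2 * 3 ^ (2 * b)
    form {q} q∈ = go (suc-part-1mod4 (in-L q∈) (%-% 4 8 (divides 2 refl) q (q%8 q∈)))
      where
      go : ∃[ b ] suc q ≡ 2 * 3 ^ suc b → ∃[ b ] suc q ≡ 2 * 3 ^ (2 * b)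
      go (b , eq) with half-cases (suc b)
      ... | h , inj₁ 1+b≡ = h , trans eq (cong (λ b → 2 * 3 ^ b) 1+b≡)
      ... | h , inj₂ 1+b≡ = case trans (sym (add-mod 8 1 q refl (q%8 q∈))) (trans (cong (_% 8) (trans eq (cong (λ b → 2 * 3 ^ b) 1+b≡)))
          (mul-mod 8 2 (3 ^ (1 + 2 * h)) refl (mul-mod 8 3 (3 ^ (2 * h)) refl
            (trans (cong (_% 8) (^-double 3 h)) (pow-mod1 8 9 refl h))))) of λ ()

  absurd : ⊥
  absurd with halve 2 be | halve 3 bf
  ... | odd bh _ 2^e≡ σe≡ | _ = odd-e bh 2^e≡ σe≡
  ... | even bh _ 2^e≡ σe≡ | odd bk _ 3^f≡ σf≡ = odd-f bh bk 2^e≡ σe≡ 3^f≡ σf≡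
  ... | even bh _ 2^e≡ σe≡ | even {k} bk f≡ 3^f≡ σf≡ with halve 4 bh | halve 9 bk
  ...   | odd bh′ _ 4^h≡ σh≡ | _ = 2-mod-4-e bh′ bk (trans 2^e≡ 4^h≡) (trans σe≡ σh≡) 3^f≡ σf≡
  ...   | even bh′ _ 4^h≡ σh≡ | odd bk′ _ 9^k≡ σk≡ = 2-mod-4-f bh′ bk′ (trans 2^e≡ 4^h≡) (trans σe≡ σh≡) (trans 3^f≡ 9^k≡) (trans σf≡ σk≡)
  ...   | even bh′ _ 4^h≡ σh≡ | even bk′ _ 9^k≡ σk≡ = 0-mod-4 {l = k} bh′ bk′ (trans σe≡ σh≡) (trans σf≡ σk≡) f≡

-- Even N with p = 5.

module EvenCase-4 (S : EvenCase 4) where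
  open EvenCase S
  open EvenCaseProperties S

  module _ {k} (bk : Bits k) (5^f≡ : 5 ^ f ≡ 5 * 25 ^ k) (σf≡ : Σbits 5 bf ≡ 6 * Σbits 25 bk) where
    lemma : ∀ c x y → x * (c * y) ≡ c * (x * y)
    lemma = solve-∀

    -- 4 and 3 in N with 5 in M: (5/4)(4/3)(6/5) = 2.
    3∈⇒⊥ : 3 ∈ L′ → ⊥
    3∈⇒⊥ 3∈ = case extract 3∈ L′-unique of λ { (L″ , L′↭ , _) →
      density′ 24 6 20 5 L″ 2 be 25 bk (s≤s z≤n) ≤-refl (m≤m+n 6 14)
        (trans (l₁ (product L″)) (trans (cong (λ y → 2 * (4 * y)) (sym (product-↭ L′↭))) (trans (sym N≡′)
          (trans (cong (Σbits 2 be *_) σf≡) (lemma 6 (Σbits 2 be) (Σbits 25 bk))))))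
        (trans (*-assoc 5 4 (product (map suc L″))) (trans (cong (5 *_) (sym (product-↭ (Perm.map⁺ suc L′↭)))) (trans M≡′
          (trans (cong (2 ^ e *_) 5^f≡) (lemma 5 (2 ^ e) (25 ^ k)))))) }
      where
      l₁ : ∀ y → 24 * y ≡ 2 * (4 * (3 * y))
      l₁ = solve-∀

    -- For even e, 2N has only one factor 3, coming from p + 1 = 6. For odd e the component 2 of M
    -- joins in: (5/4)(10/9)(6/5)(3/2) > 2.
    9∈⇒⊥ : 9 ∈ L′ → ⊥
    9∈⇒⊥ 9∈ with halve 2 be
    ... | even bh _ _ σe≡ = prime∤⇒∤* prime[3] 2 (Σbits 4 bh * Σbits 25 bk)
            (λ 3∣2 → case ∣⇒≤ 3∣2 of λ { (s≤s (s≤s ())) })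
            (prime∤⇒∤* prime[3] (Σbits 4 bh) (Σbits 25 bk) (3∤Σbits 2 bh) (3∤Σbits 5 bk))
            (*-cancelˡ-∣ 3 (subst (9 ∣_) (trans (cong₂ _*_ σe≡ σf≡) (trans (lemma 6 (Σbits 4 bh) (Σbits 25 bk)) (*-assoc 3 2 (Σbits 4 bh * Σbits 25 bk)))) (∈L′⇒∣2N 9∈)))
    ... | odd {h} bh _ 2^e≡ σe≡ = case extract 9∈ L′-unique of λ { (L″ , L′↭ , _) →
      density′ 72 18 50 10 L″ 4 bh 25 bk (s≤s z≤n) (m≤m+n 720 180) (m≤m+n 11 39)
        (trans (l₁ (product L″)) (trans (cong (λ y → 2 * (4 * y)) (sym (product-↭ L′↭))) (trans (sym N≡′)
          (trans (cong₂ _*_ σe≡ σf≡) (l₂ (Σbits 4 bh) (Σbits 25 bk))))))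
        (trans (*-assoc 5 10 (product (map suc L″))) (trans (cong (5 *_) (sym (product-↭ (Perm.map⁺ suc L′↭)))) (trans M≡′
          (trans (cong₂ _*_ 2^e≡ 5^f≡) (l₃ (4 ^ h) (25 ^ k)))))) }
      where
      l₁ : ∀ y → 72 * y ≡ 2 * (4 * (9 * y))
      l₁ = solve-∀
      l₂ : ∀ x y → 3 * x * (6 * y) ≡ 18 * (x * y)
      l₂ = solve-∀
      l₃ : ∀ x y → 2 * x * (5 * y) ≡ 10 * (x * y)
      l₃ = solve-∀

    odd-f⇒⊥ : ⊥
    odd-f⇒⊥ = go (OddF.3-part refl bk 5^f≡ σf≡)
      where
      go : ∃[ l ] 3 ^ (2 ^ l) ∈ L′ → ⊥
      go (0 , 3∈) = 3∈⇒⊥ 3∈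
      go (1 , 9∈) = 9∈⇒⊥ 9∈
      -- A power of 81 is 1 modulo 5, so 1 + q is not divisible by 5.
      go (2+ l , q∈) = contra (suc-part-1mod4 (in-L q∈) (3²^%4 (suc l)))
        where
        contra : ∃[ b ] suc (3 ^ (2 ^ (2 + l))) ≡ 2 * 5 ^ suc b → ⊥
        contra (b , eq) = case trans (sym (add-mod 5 1 (3 ^ (2 ^ (2 + l))) refl (trans (cong (_% 5)
            (trans (^-double 3 (2 ^ suc l)) (^-double 9 (2 ^ l)))) (pow-mod1 5 81 refl (2 ^ l)))))
          (n∣m⇒m%n≡0 _ 5 (subst (5 ∣_) (sym eq) (∣n⇒∣m*n 2 (m∣m*n (5 ^ b))))) of λ ()

  absurd : ⊥
  absurd with halve 5 bf
  ... | even bk f≡ _ σf≡ = even-f⇒⊥ refl bk f≡ σf≡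
  ... | odd bk _ 5^f≡ σf≡ = odd-f⇒⊥ bk 5^f≡ σf≡

even-case⇒⊥ : ∀ i → EvenCase (2 ^ (2 ^ i)) → ⊥
even-case⇒⊥ 0 S = EvenCase-2.absurd S
even-case⇒⊥ 1 S = EvenCase-4.absurd S
even-case⇒⊥ (2+ i) S = go (power-of-16 i) S
  where
  power-of-16 : ∀ i → ∃[ n ] 2 ^ (2 ^ (2 + i)) ≡ 16 * 16 ^ n
  power-of-16 i = pred (2 ^ i) , trans (^-double 2 (2 ^ suc i)) (trans (^-double 4 (2 ^ i)) (cong (16 ^_) (sym (suc-pred (2 ^ i) {{m^n≢0 2 i}}))))
  go : ∃[ n ] 2 ^ (2 ^ (2 + i)) ≡ 16 * 16 ^ n → EvenCase (2 ^ (2 ^ (2 + i))) → ⊥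
  go (n , G≡) S = absurd
    where
    open EvenCase S using (f; bf)
    open EvenCaseProperties S
    p%3′ : p % 3 ≡ 2
    p%3′ = trans (cong (λ G → suc G % 3) G≡) (add-mod 3 1 (16 ^ suc n) refl (pow-mod1 3 16 refl (suc n)))
    absurd : ⊥
    absurd with halve p bf
    ... | even bk f≡ _ σf≡ = even-f⇒⊥ p%3′ bk f≡ σf≡
    ... | odd bk _ p^f≡ σf≡ = OddF.Large.absurd p%3′ bk p^f≡ σf≡ {n} G≡

-- The primes of M and the assembly of the cases.

two-odd-primes : ∀ M → .{{NonZero M}} → 2 ∣ M → ω M ≤ 2 →
  ∃[ p ] Prime p × p % 2 ≡ 1 × (∀ {r} → Prime r → r ∣ M → r ≡ 2 ⊎ r ≡ p)
two-odd-primes M 2∣M ω≤2 = go primes is-prime divisor ω≤2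
  where
  primes : List ℕ
  primes = filter (λ p → p ∣? M) (primesUpTo M)
  is-prime : ∀ {r} → r ∈ primes → Prime r
  is-prime r∈ = proj₂ (∈-filter⁻ prime? {xs = upTo (suc M)} (proj₁ (∈-filter⁻ (λ p → p ∣? M) {xs = primesUpTo M} r∈)))
  divisor : ∀ {r} → Prime r → r ∣ M → r ∈ primes
  divisor pr r∣M = ∈-filter⁺ (λ p → p ∣? M) (∈-filter⁺ prime? (∈-upTo⁺ (s≤s (∣⇒≤ r∣M))) pr) r∣M
  Goal : Set
  Goal = ∃[ p ] Prime p × p % 2 ≡ 1 × (∀ {r} → Prime r → r ∣ M → r ≡ 2 ⊎ r ≡ p)
  choose : ∀ {y} → Prime y → (∀ {r} → Prime r → r ∣ M → r ≡ 2 ⊎ r ≡ y) → Goal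
  choose {y} py h with 2-or-odd py
  ... | inj₂ y-odd = y , py , y-odd , h
  -- Here M is a power of 2; 3 stands in as the second prime, so that both cases have the form 2 ^ e
  -- p ^ f.
  ... | inj₁ refl = 3 , prime[3] , refl , λ pr r∣M → case h pr r∣M of λ { (inj₁ eq) → inj₁ eq ; (inj₂ eq) → inj₁ eq }
  go : ∀ xs → (∀ {r} → r ∈ xs → Prime r) → (∀ {r} → Prime r → r ∣ M → r ∈ xs) → length xs ≤ 2 → Goal
  go [] _ div _ = case div prime[2] 2∣M of λ ()
  go (x ∷ []) isp div _ = choose (isp (here refl)) λ pr r∣M → case div pr r∣M of λ { (here eq) → inj₂ eq ; (there ()) }
  go (x ∷ y ∷ []) isp div _ = case div prime[2] 2∣M of λ
    { (here refl) → choose (isp (there (here refl))) λ pr r∣M → case div pr r∣M of λ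
        { (here eq) → inj₁ eq ; (there (here eq)) → inj₂ eq ; (there (there ())) }
    ; (there (here refl)) → choose (isp (here refl)) λ pr r∣M → case div pr r∣M of λ
        { (here eq) → inj₂ eq ; (there (here eq)) → inj₁ eq ; (there (there ())) }
    ; (there (there ())) }
  go (_ ∷ _ ∷ _ ∷ _) _ _ (s≤s (s≤s ()))

2^p^-form : ∀ {p} → Prime p → ∀ M → .{{NonZero M}} → (∀ {r} → Prime r → r ∣ M → r ≡ 2 ⊎ r ≡ p) → ∃[ e ] ∃[ f ] M ≡ 2 ^ e * p ^ f
2^p^-form {p} pp M only with split-power prime[2] M
... | e , m , refl , 2∤m with split-power pp m {{∤⇒NonZero 2∤m}}
...   | f , m′ , refl , p∤m′ = e , f , cong (2 ^ e *_) (trans (cong (p ^ f *_) m′≡1) (*-identityʳ (p ^ f)))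
  where
  m′≡1 : m′ ≡ 1
  m′≡1 = no-prime-divisor⇒1 {{∤⇒NonZero p∤m′}} λ {r} pr r∣m′ → case only pr (∣n⇒∣m*n (2 ^ e) (∣n⇒∣m*n (p ^ f) r∣m′)) of λ
    { (inj₁ refl) → 2∤m (∣n⇒∣m*n (p ^ f) r∣m′) ; (inj₂ refl) → p∤m′ r∣m′ }

σ∞-2^p^ : ∀ {p} → Prime p → p % 2 ≡ 1 → ∀ {e f} (be : Bits e) (bf : Bits f) → σ∞ (2 ^ e * p ^ f) ≡ Σbits 2 be * Σbits p bf
σ∞-2^p^ {p} pp p-odd {e} {f} be bf = trans (σ∞-^* prime[2] be (λ 2∣ → odd⇒2∤ p p-odd (prime∣^ prime[2] p f 2∣)))
  (cong (Σbits 2 be *_) (trans (cong σ∞ (sym (*-identityʳ (p ^ f))))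
    (trans (σ∞-^* pp bf (λ p∣1 → ¬prime[1] (subst Prime (∣1⇒≡1 p∣1) pp))) (*-identityʳ (Σbits p bf)))))

-- For a component G = 2 ^ 2 ^ i the number 1 + G is odd, hence a power of p, hence p itself. So p
-- determines G, and all other components are odd.
even-N⇒⊥ : ∀ {p} → Prime p → p % 2 ≡ 1 → ∀ {L} → Unique L → (∀ {q} → q ∈ L → IsComp q) →
  ∀ {e f} → product (map suc L) ≡ 2 ^ e * p ^ f → (be : Bits e) (bf : Bits f) →
  Σbits 2 be * Σbits p bf ≡ 2 * product L → 2 ∣ product (map suc L) → 2 ∣ product L → ⊥
even-N⇒⊥ {p} pp p-odd {L} L-unique isComp {e} {f} M≡ be bf N≡ 2∣M 2∣N = go (prime-part prime[2] 2∣N)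
  where
  open Parts pp p-odd isComp {e} {f} M≡
  power-of-2 : ∀ i → 2 ^ (2 ^ i) ∈ L → p ≡ suc (2 ^ (2 ^ i))
  power-of-2 i G∈ = from (suc-part G∈)
    where
    G : ℕ
    G = 2 ^ (2 ^ i)
    2∣G : 2 ∣ G
    2∣G = n∣n^ 2 (2 ^ i) {{m^n≢0 2 i}}
    from : ∃[ a ] ∃[ b ] suc G ≡ 2 ^ a * p ^ b → p ≡ suc G
    from (zero , b , eq) = fermat-prime-power i p-odd b (trans eq (*-identityˡ (p ^ b)))
    from (suc a , b , eq) = case ∣1⇒≡1 (∣m+n∣m⇒∣n (subst (2 ∣_) (trans (sym eq) (+-comm 1 G)) (∣m⇒∣m*n (p ^ b) (m∣m*n (2 ^ a)))) 2∣G) of λ ()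
  go : ∃[ i ] 2 ^ (2 ^ i) ∈ L → ⊥
  go (i , G∈) = even-case⇒⊥ i (build (extract G∈ L-unique) (power-of-2 i G∈))
    where
    G : ℕ
    G = 2 ^ (2 ^ i)
    build : ∃[ L′ ] L ↭ G ∷ L′ × Unique (G ∷ L′) → p ≡ suc G → EvenCase G
    build (L′ , L↭ , G∉ ∷ L′-unique) p≡ = record
      { pp = subst Prime p≡ pp
      ; p-odd = subst (λ p → p % 2 ≡ 1) p≡ p-odd
      ; g = 2 ^ i
      ; G≡ = refl
      ; isComp = isComp
      ; M≡ = subst (λ p → product (map suc L) ≡ 2 ^ e * p ^ f) p≡ M≡
      ; be = be
      ; bf = bf
      ; N≡ = subst (λ p → Σbits 2 be * Σbits p bf ≡ 2 * product L) p≡ N≡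
      ; L↭ = L↭
      ; L′-unique = L′-unique
      ; rest-odd = rest-odd
      ; 2∣M = 2∣M
      }
      where
      rest-odd : ∀ {q} → q ∈ L′ → q % 2 ≡ 1
      rest-odd q∈ with isComp (∈-resp-↭ (↭-sym L↭) (there q∈))
      ... | r , l , pr , refl with 2-or-odd pr
      ...   | inj₂ r-odd = pow-mod1 2 r r-odd (2 ^ l)
      ...   | inj₁ refl = ⊥-elim (All.lookup G∉ q∈ (suc-injective (trans (sym p≡) (power-of-2 l (∈-resp-↭ (↭-sym L↭) (there q∈))))))

1mod4⇒odd-prime∣suc : ∀ q → q % 4 ≡ 1 → 1 < q → ∃[ t ] Prime t × t ≢ 2 × t ∣ suc q
1mod4⇒odd-prime∣suc q q%4 1<q = go (q / 4) (trans (m≡m%n+[m/n]*n q 4) (cong (_+ q / 4 * 4) q%4))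
  where
  go : ∀ k → q ≡ 1 + k * 4 → ∃[ t ] Prime t × t ≢ 2 × t ∣ suc q
  go zero eq = contradiction eq (>⇒≢ 1<q)
  go k@(suc _) eq with prime-divisor (1 + 2 * k) (s≤s (s≤s z≤n))
  ... | t , pt , t∣ = t , pt , (λ { refl → 2∤odd k t∣ }) , ∣-trans t∣ (divides 2 (trans (cong suc eq) (lemma k)))
    where
    lemma : ∀ k → 2 + k * 4 ≡ 2 * (1 + 2 * k)
    lemma = solve-∀

-- A component 2 ^ 2 ^ l of N with l ≥ 1 gives a prime s ≡ 1 mod 4 dividing M, and so a component of
-- M that is 1 mod 4. One more than that component is twice an odd number above 1, so an odd prime
-- divides 2N, although N is a power of 2.
odd-M⇒N≡2 : ∀ N → .{{NonZero N}} → σ∞ (σ∞ N) ≡ 2 * N → ¬ 2 ∣ σ∞ N → N ≡ 2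
odd-M⇒N≡2 N eq 2∤M = conclude parts unique all-2 product≡
  where
  open Decomposition (decompose N)
  M≢0 : NonZero (σ∞ N)
  M≢0 = ∤⇒NonZero 2∤M
  module DM = Decomposition (decompose (σ∞ N) {{M≢0}})
  suc∣M : ∀ {q} → q ∈ parts → suc q ∣ σ∞ N
  suc∣M q∈ = subst (_ ∣_) σ≡ (∈⇒∣product (∈-map⁺ suc q∈))
  power-of-2 : ∀ {q} → q ∈ parts → ∃[ l ] q ≡ 2 ^ (2 ^ l)
  power-of-2 q∈ with isComp q∈
  ... | r , l , pr , refl with 2-or-odd pr
  ...   | inj₁ refl = l , refl
  ...   | inj₂ r-odd = contradiction (∣-trans (2∣suc-odd {r ^ (2 ^ l)} (pow-mod1 2 r r-odd (2 ^ l))) (suc∣M q∈)) 2∤M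
  prime∣N⇒2 : ∀ {t} → Prime t → t ∣ N → t ≡ 2
  prime∣N⇒2 {t} pt t∣N with prime∣product pt parts (subst (t ∣_) (sym product≡) t∣N)
  ... | q , q∈ , t∣q with power-of-2 q∈
  ...   | l , refl = prime∣prime pt prime[2] (prime∣^ pt 2 (2 ^ l) t∣q)
  all-2 : ∀ {q} → q ∈ parts → q ≡ 2
  all-2 q∈ with power-of-2 q∈
  ... | zero , refl = refl
  ... | suc l , refl with prime-divisor (suc (2 ^ (2 ^ suc l))) (s≤s (m^n>0 2 (2 ^ suc l)))
  ...   | s , ps , s∣ with prime-part-of ps DM.parts DM.isComp (subst (s ∣_) (sym DM.product≡) (∣-trans s∣ (suc∣M q∈)))
  ...     | l′ , q′∈ with 1mod4⇒odd-prime∣suc (s ^ (2 ^ l′)) (pow-mod1 4 s s%4 (2 ^ l′)) (IsComp>1 (s , l′ , ps , refl))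
    where
    s-odd : s % 2 ≡ 1
    s-odd with 2-or-odd ps
    ... | inj₂ eq′ = eq′
    ... | inj₁ refl = contradiction (∣-trans s∣ (suc∣M q∈)) 2∤M
    s%4 : s % 4 ≡ 1
    s%4 = ∣y²+1⇒1mod4 s s-odd (2 ^ (2 ^ l)) (subst (s ∣_) (trans (cong suc (^-double-* 2 (2 ^ l))) (+-comm 1 _)) s∣)
  ...       | t , pt , t≢2 , t∣ = contradiction t≡2 t≢2
    where
    t∣2N : t ∣ 2 * N
    t∣2N = subst (t ∣_) (trans DM.σ≡ eq) (∣-trans t∣ (∈⇒∣product (∈-map⁺ suc q′∈)))
    t≡2 : t ≡ 2
    t≡2 with euclidsLemma 2 N pt t∣2N
    ... | inj₁ t∣2 = prime∣prime pt prime[2] t∣2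
    ... | inj₂ t∣N = prime∣N⇒2 pt t∣N
  conclude : ∀ L → Unique L → (∀ {q} → q ∈ L → q ≡ 2) → product L ≡ N → N ≡ 2
  -- N = 1 is excluded by evaluating both sides: 1 against 2.
  conclude [] _ _ 1≡N = case subst (λ N → σ∞ (σ∞ N) ≡ 2 * N) (sym 1≡N) eq of λ ()
  conclude (q ∷ []) _ all2 q*1≡N = trans (sym q*1≡N) (trans (*-identityʳ q) (all2 (here refl)))
  conclude (q ∷ q′ ∷ _) ((q≢q′ ∷ _) ∷ _) all2 _ = contradiction (trans (all2 (here refl)) (sym (all2 (there (here refl))))) q≢q′

even-M⇒N≡9 : ∀ N → .{{NonZero N}} → σ∞ (σ∞ N) ≡ 2 * N → ω (σ∞ N) ≤ 2 → 2 ∣ σ∞ N → N ≡ 9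
even-M⇒N≡9 N eq ω≤2 2∣M = go (two-odd-primes (σ∞ N) 2∣M ω≤2)
  where
  open Decomposition (decompose N)
  instance
    M≢0 : NonZero (σ∞ N)
    M≢0 = subst NonZero σ≡ (product≢0 (All.tabulate λ q∈ → suc≢0 (∈-map⁻ suc q∈)))
      where
      suc≢0 : ∀ {q} → ∃[ q′ ] q′ ∈ parts × q ≡ suc q′ → NonZero q
      suc≢0 (_ , _ , refl) = _
  go : ∃[ p ] Prime p × p % 2 ≡ 1 × (∀ {r} → Prime r → r ∣ σ∞ N → r ≡ 2 ⊎ r ≡ p) → N ≡ 9
  go (p , pp , p-odd , only) with 2^p^-form pp (σ∞ N) only
  ... | e , f , M≡ = by-parity (2 ∣? product parts)
    where
    M≡′ : product (map suc parts) ≡ 2 ^ e * p ^ f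
    M≡′ = trans σ≡ M≡
    N≡′ : Σbits 2 (bits e) * Σbits p (bits f) ≡ 2 * product parts
    N≡′ = trans (sym (σ∞-2^p^ pp p-odd (bits e) (bits f))) (trans (cong σ∞ (sym M≡)) (trans eq (cong (2 *_) (sym product≡))))
    2∣M′ : 2 ∣ product (map suc parts)
    2∣M′ = subst (2 ∣_) (sym σ≡) 2∣M
    by-parity : Dec (2 ∣ product parts) → N ≡ 9
    by-parity (yes 2∣N) = ⊥-elim (even-N⇒⊥ pp p-odd unique isComp M≡′ (bits e) (bits f) N≡′ 2∣M′ 2∣N)
    by-parity (no 2∤N) = trans (sym product≡) (OddCase.N≡9 pp p-odd unique isComp M≡′ (bits e) (bits f) N≡′ 2∤N 2∣M′)

theorem1p2 : (N : ℕ) → .{{_ : NonZero N}} → σ∞ (σ∞ N) ≡ 2 * N → ω (σ∞ N) ≤ 2 → N ≡ 2 ⊎ N ≡ 9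
theorem1p2 N eq ω≤2 with 2 ∣? σ∞ N
... | yes 2∣M = inj₂ (even-M⇒N≡9 N eq ω≤2 2∣M)
... | no 2∤M = inj₁ (odd-M⇒N≡2 N eq 2∤M)
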